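{- There is a primitive recursive function $k_0:\omega\to\omega$ such that for all $e,m\in\omega$ and all $X\in{}^{\omega}\omega$, $$\{e\}^{\mathsf{E}}(m,X)\;\simeq\;\langle k_0(e)\rangle^X(m).$$ Here $\simeq$ means that either both sides converge and have the same value in $\omega$, or neither side converges.
   Context: Finite sequences of integers are coded by integers in a fixed recursive way, so single integer inputs may stand for tuples. **The functional $\mathsf{E}={}^2\mathsf{E}$.** $\mathsf{E}:{}^{\omega}\omega\to\{0,1\}$ is defined by $\mathsf{E}(y)=0$ if $\exists n\; y(n)=0$, and $\mathsf{E}(y)=1$ if $\forall n\; y(n)\neq 0$. **Kleene recursion in $\mathsf{E}$ (Turing machine model).** Programs are ordinary oracle Turing machine programs (with oracle $X$), indexed by $e\in\omega$ in a standard way, with an additional instruction allowing the machine at any stage to issue a query $Q(e',m',X)$, with $e',m'$ integers computed by the machine and the oracle $X$ held fixed. The query asks for the $\omega$-sequence of computations of program $e'$ on inputs $(m',k)$, $k=0,1,2,\dots$, with oracle $X$; if all of them converge, with values $y(k)$, then the integer $\mathsf{E}(y)$, $y=\lambda k.y(k)$, is returned to the calling computation in one step. Formally, for a set $C$ of pairs let $\Gamma(C)$ be the set of pairs $\langle\langle e,m,X\rangle,n\rangle$ such that program $e$ run on input $m$ with oracle $X$ halts with output $n$, where it makes only queries $Q(e',m',X)$ for which there is $y\in{}^{\omega}\omega$ with $\langle\langle e',(m',k),X\rangle,y(k)\rangle\in C$ for all $k\in\omega$, and each such query is answered by $\mathsf{E}(y)$. Let $\Gamma_\infty$ be the least fixed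 point of the monotone operator $\Gamma$, obtained by iteration from $\emptyset$. Then $\{e\}^{\mathsf{E}}(m,X)$ converges with value $n$ iff $\langle\langle e,m,X\rangle,n\rangle\in\Gamma_\infty$; it is undefined (divergent) if there is no such $n$. **Feedback computation.** Programs are ordinary oracle Turing machine programs (with oracle $X$), indexed by $e\in\omega$ in a standard way, with an additional instruction allowing the machine at any stage to issue a query $Q^X(e',m')$, with $e',m'$ integers computed by the machine, asking whether the feedback computation $\langle e'\rangle^X(m')$ converges or diverges, and receiving (in one step) an answer in $\{\downarrow,\uparrow\}$. Formally, for a partial function $C$ let $I(C)$ be the set of pairs $\langle\langle e,m,X\rangle,\langle j,k\rangle\rangle$ such that program $e$, run on input $m$ with oracle $X$, makes only queries $Q^X(e',m')$ for which $C(\langle e',m',X\rangle)=\langle j',k'\rangle$ is defined, each such query being answered by $j'$, and either this run halts with output $k\in\omega$ and $j=\,\downarrow$, or it runs forever and $j=\,\uparrow$, $k=\omega$. Let $I_\infty$ be the least fixed point of the monotone operator $I$, obtained by iteration from $\emptyset$. Then $\langle e\rangle^X(m)$ converges with value $k$ iff $I_\infty(\langle e,m,X\rangle)=\langle\downarrow,k\rangle$; it diverges iff $I_\infty(\langle e,m,X\rangle)=\langle\uparrow,\omega\rangle$; and it is freezing (undefined) iff $\langle e,m,X\rangle\notin\mathrm{dom}(I_\infty)$. Both the divergent and the freezing case count as "not converging" in $\simeq$. -}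

module Defs where

open import Data.Bool.Base using (Bool; true; false)
open import Data.Fin.Base using (Fin)
open import Data.List.Base using (List; []; _∷_; drop; head; map; replicate)
open import Data.Maybe.Base using (Maybe; just; nothing)
open import Data.Nat.Base using (ℕ; zero; suc; _+_; _≤_; s≤s)
open import Data.Nat.Properties
  using (_≟_; +-comm; +-suc; +-identityʳ; ≤-trans; ≤-refl; m≤n+m)
open import Data.Product.Base using (Σ-syntax; ∃-syntax; _×_; _,_; proj₁; proj₂)
open import Data.Vec.Base using (Vec; []; _∷_; lookup)
open import Function.Bundles using (_⇔_)
open import Relation.Binary.Construct.Closure.ReflexiveTransitive using (Star)
open import Relation.Binary.PropositionalEquality
  using (_≡_; _≢_; refl; sym; trans; cong; cong₂)
open import Relation.Nullary.Decidable.Core using (yes; no)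

------------------------------------------------------------------------
-- Primitive recursive functions

data PR : ℕ → Set where
  zeroᵖ : ∀ {n} → PR n
  sucᵖ  : PR 1
  proj  : ∀ {n} → Fin n → PR n
  comp  : ∀ {m n} → PR m → Vec (PR n) m → PR n
  rec   : ∀ {n} → PR n → PR (suc (suc n)) → PR (suc n)

mutual
  eval : ∀ {n} → PR n → Vec ℕ n → ℕ
  eval zeroᵖ       xs           = 0
  eval sucᵖ        (x ∷ [])     = suc x
  eval (proj i)    xs           = lookup xs i
  eval (comp f gs) xs           = eval f (evals gs xs)
  eval (rec g h)   (zero  ∷ xs) = eval g xs
  eval (rec g h)   (suc x ∷ xs) = eval h (x ∷ eval (rec g h) (x ∷ xs) ∷ xs)

  evals : ∀ {m n} → Vec (PR n) m → Vec ℕ n → Vec ℕ m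
  evals []       xs = []
  evals (g ∷ gs) xs = eval g xs ∷ evals gs xs

PrimitiveRecursive : (ℕ → ℕ) → Set
PrimitiveRecursive f = Σ[ p ∈ PR 1 ] ∀ x → eval p (x ∷ []) ≡ f x

------------------------------------------------------------------------
-- Coding of pairs and finite sequences

triangle : ℕ → ℕ
triangle zero    = 0
triangle (suc n) = suc n + triangle n

-- The Cantor pairing bijection.
pair : ℕ → ℕ → ℕ
pair x y = triangle (x + y) + y

-- `unpair` walks along the diagonals (0,0), (1,0), (0,1), (2,0), (1,1), …
next : ℕ × ℕ → ℕ × ℕ
next (zero  , y) = suc y , 0
next (suc x , y) = x , suc y

unpair : ℕ → ℕ × ℕ
unpair zero    = 0 , 0
unpair (suc n) = next (unpair n)

π₁ π₂ : ℕ → ℕ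
π₁ n = proj₁ (unpair n)
π₂ n = proj₂ (unpair n)

encodeSeq : List ℕ → ℕ
encodeSeq []       = 0
encodeSeq (x ∷ xs) = suc (pair x (encodeSeq xs))

-- The first argument is fuel; the code itself always suffices.
decodeSeqWith : ℕ → ℕ → List ℕ
decodeSeqWith _       zero    = []
decodeSeqWith zero    (suc n) = []
decodeSeqWith (suc f) (suc n) = π₁ n ∷ decodeSeqWith f (π₂ n)

decodeSeq : ℕ → List ℕ
decodeSeq n = decodeSeqWith n n

------------------------------------------------------------------------
-- Turing machine programs

-- A tape is infinite in both directions, with cell symbols `false` (blank)
-- and `true` (a stroke).  `right` lists the cells from the scanned cell
-- rightwards, `left` those to its left, nearest first; all cells beyond the
-- two lists are blank.
record Tape : Set where
  constructor tape
  field
    left right : List Bool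

data Direction : Set where
  L R stay : Direction

scanned : Tape → Bool
scanned (tape l [])      = false
scanned (tape l (s ∷ r)) = s

write : Bool → Tape → Tape
write s (tape l [])      = tape l (s ∷ [])
write s (tape l (_ ∷ r)) = tape l (s ∷ r)

move : Direction → Tape → Tape
move L    (tape [] r)      = tape [] (false ∷ r)
move L    (tape (s ∷ l) r) = tape l (s ∷ r)
move R    (tape l [])      = tape (false ∷ l) []
move R    (tape l (s ∷ r)) = tape (s ∷ l) r
move stay t                = t

-- Integers on tapes are in unary: n is a block of n strokes starting at the
-- scanned cell and followed by a blank.
strokes : List Bool → ℕ
strokes (true ∷ r) = suc (strokes r)
strokes _          = 0

number : Tape → ℕ
number t = strokes (Tape.right t)

numeral : ℕ → Tape
numeral n = tape [] (replicate n true)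

record Action : Set where
  constructor action
  field
    symbol    : Bool
    direction : Direction
    goto      : ℕ

-- A program is the table of a multitape Turing machine: the instruction at
-- position q is what is done in state q.
--
--   act i a₀ a₁ : scan tape i and perform a₀ or a₁ according as the scanned
--                 symbol is blank or a stroke (i.e. the two quintuples of
--                 state q);
--   oracle i r  : replace the integer n on tape i by X(n), and enter state r;
--   query i j r : issue the query Q(e′,m′), with e′ on tape i and m′ on tape
--                 j, replace tape j by the answer, and enter state r.
--
-- States without instruction are the halting states.  There is a supply of
-- tapes indexed by ℕ, of which any one program mentions only finitely many.
data Instruction : Set where
  act    : (i : ℕ) (a₀ a₁ : Action) → Instruction
  oracle : (i r : ℕ) → Instruction
  query  : (i j r : ℕ) → Instruction

Program : Set
Program = List Instruction

------------------------------------------------------------------------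
-- The indexing of programs: every e is the index of a program, and every
-- program has an index (`program-index` below)

decodeSymbol : ℕ → Bool
decodeSymbol zero    = false
decodeSymbol (suc _) = true

decodeDirection : ℕ → Direction
decodeDirection 0             = L
decodeDirection 1             = R
decodeDirection (suc (suc _)) = stay

decodeAction : ℕ → Action
decodeAction n =
  action (decodeSymbol (π₁ n)) (decodeDirection (π₁ (π₂ n))) (π₂ (π₂ n))

decodeTagged : (tag body : ℕ) → Instruction
decodeTagged 0 b             = oracle (π₁ b) (π₂ b)
decodeTagged 1 b             = query (π₁ b) (π₁ (π₂ b)) (π₂ (π₂ b))
decodeTagged (suc (suc _)) b =
  act (π₁ b) (decodeAction (π₁ (π₂ b))) (decodeAction (π₂ (π₂ b)))

decodeInstruction : ℕ → Instruction
decodeInstruction n = decodeTagged (π₁ n) (π₂ n)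

program : ℕ → Program
program e = map decodeInstruction (decodeSeq e)

encodeSymbol : Bool → ℕ
encodeSymbol false = 0
encodeSymbol true  = 1

encodeDirection : Direction → ℕ
encodeDirection L    = 0
encodeDirection R    = 1
encodeDirection stay = 2

encodeAction : Action → ℕ
encodeAction (action s d g) =
  pair (encodeSymbol s) (pair (encodeDirection d) g)

encodeInstruction : Instruction → ℕ
encodeInstruction (oracle i r)  = pair 0 (pair i r)
encodeInstruction (query i j r) = pair 1 (pair i (pair j r))
encodeInstruction (act i a₀ a₁) =
  pair 2 (pair i (pair (encodeAction a₀) (encodeAction a₁)))

index : Program → ℕ
index p = encodeSeq (map encodeInstruction p)

unpair-diagonal : ∀ s y x → x + y ≡ s → unpair (triangle s + y) ≡ (x , y)
unpair-diagonal zero    zero    zero    _    = refl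
unpair-diagonal zero    zero    (suc x) ()
unpair-diagonal (suc s) zero    x       eq
  rewrite +-identityʳ (s + triangle s)
        | +-comm s (triangle s)
        | unpair-diagonal s s 0 refl
        = cong (_, 0) (trans (sym eq) (+-identityʳ x))
unpair-diagonal s       (suc y) x       eq
  rewrite +-suc (triangle s) y
        | unpair-diagonal s y (suc x) (trans (sym (+-suc x y)) eq)
        = refl

unpair-pair : ∀ x y → unpair (pair x y) ≡ (x , y)
unpair-pair x y = unpair-diagonal (x + y) y x refl

decodeSeqWith-encodeSeq : ∀ f xs → encodeSeq xs ≤ f →
                          decodeSeqWith f (encodeSeq xs) ≡ xs
decodeSeqWith-encodeSeq f       []       _ = refl
decodeSeqWith-encodeSeq (suc f) (x ∷ xs) (s≤s le)
  rewrite unpair-pair x (encodeSeq xs) =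
  cong (x ∷_) (decodeSeqWith-encodeSeq f xs
    (≤-trans (m≤n+m (encodeSeq xs) (triangle (x + encodeSeq xs))) le))

decodeSeq-encodeSeq : ∀ xs → decodeSeq (encodeSeq xs) ≡ xs
decodeSeq-encodeSeq xs = decodeSeqWith-encodeSeq (encodeSeq xs) xs ≤-refl

decode-encodeSymbol : ∀ s → decodeSymbol (encodeSymbol s) ≡ s
decode-encodeSymbol false = refl
decode-encodeSymbol true  = refl

decode-encodeDirection : ∀ d → decodeDirection (encodeDirection d) ≡ d
decode-encodeDirection L    = refl
decode-encodeDirection R    = refl
decode-encodeDirection stay = refl

decode-encodeAction : ∀ a → decodeAction (encodeAction a) ≡ a
decode-encodeAction (action s d g)
  rewrite unpair-pair (encodeSymbol s) (pair (encodeDirection d) g)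
        | unpair-pair (encodeDirection d) g
        | decode-encodeSymbol s
        | decode-encodeDirection d = refl

decode-encodeInstruction : ∀ c → decodeInstruction (encodeInstruction c) ≡ c
decode-encodeInstruction (oracle i r)
  rewrite unpair-pair 0 (pair i r) | unpair-pair i r = refl
decode-encodeInstruction (query i j r)
  rewrite unpair-pair 1 (pair i (pair j r))
        | unpair-pair i (pair j r)
        | unpair-pair j r = refl
decode-encodeInstruction (act i a₀ a₁)
  rewrite unpair-pair 2 (pair i (pair (encodeAction a₀) (encodeAction a₁)))
        | unpair-pair i (pair (encodeAction a₀) (encodeAction a₁))
        | unpair-pair (encodeAction a₀) (encodeAction a₁)
        | decode-encodeAction a₀
        | decode-encodeAction a₁ = refl

program-index : ∀ p → program (index p) ≡ p
program-index p
  rewrite decodeSeq-encodeSeq (map encodeInstruction p) = go p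
  where
  go : ∀ p → map decodeInstruction (map encodeInstruction p) ≡ p
  go []      = refl
  go (c ∷ p) = cong₂ _∷_ (decode-encodeInstruction c) (go p)

------------------------------------------------------------------------
-- Runs

record Config : Set where
  constructor config
  field
    state : ℕ
    tapes : ℕ → Tape

_[_≔_] : (ℕ → Tape) → ℕ → Tape → ℕ → Tape
(T [ i ≔ t ]) j with j ≟ i
... | yes _ = t
... | no  _ = T j

perform : Action → ℕ → (ℕ → Tape) → Config
perform (action s d g) i T = config g (T [ i ≔ move d (write s (T i)) ])

choose : Bool → Action → Action → Action
choose false a₀ a₁ = a₀
choose true  a₀ a₁ = a₁

fetch : Program → ℕ → Maybe Instruction
fetch p q = head (drop q p)

-- The input is on tape 0, as is the output when the run halts.
initial : ℕ → Config
initial m = config 0 ((λ _ → numeral 0) [ 0 ≔ numeral m ])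

output : Config → ℕ
output (config q T) = number (T 0)

-- `Answer e′ m′ a` says that the query Q(e′,m′) is answered by the integer a;
-- when there is no such a, a run issuing this query cannot be continued.
data Step (X : ℕ → ℕ) (Answer : ℕ → ℕ → ℕ → Set) (p : Program) :
          Config → Config → Set where
  act-step : ∀ {q T i a₀ a₁} →
    fetch p q ≡ just (act i a₀ a₁) →
    Step X Answer p (config q T)
                    (perform (choose (scanned (T i)) a₀ a₁) i T)
  oracle-step : ∀ {q T i r} →
    fetch p q ≡ just (oracle i r) →
    Step X Answer p (config q T)
                    (config r (T [ i ≔ numeral (X (number (T i))) ]))
  query-step : ∀ {q T i j r a} →
    fetch p q ≡ just (query i j r) →
    Answer (number (T i)) (number (T j)) a →
    Step X Answer p (config q T)
                    (config r (T [ j ≔ numeral a ]))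

data Halts (X : ℕ → ℕ) (Answer : ℕ → ℕ → ℕ → Set) (e m n : ℕ) : Set where
  halts : ∀ {c} → Star (Step X Answer (program e)) (initial m) c →
          fetch (program e) (Config.state c) ≡ nothing → output c ≡ n →
          Halts X Answer e m n

data RunsForever (X : ℕ → ℕ) (Answer : ℕ → ℕ → ℕ → Set) (e m : ℕ) : Set where
  runs-forever : (c : ℕ → Config) → c 0 ≡ initial m →
                 (∀ t → Step X Answer (program e) (c t) (c (suc t))) →
                 RunsForever X Answer e m

------------------------------------------------------------------------
-- Kleene recursion in E

-- The graph of ²E.
data E (y : ℕ → ℕ) : ℕ → Set where
  E-zero : ∃[ n ] y n ≡ 0 → E y 0
  E-one  : (∀ n → y n ≢ 0) → E y 1

-- Here and below the oracle X is held fixed, so `C e m n` stands for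
-- ⟨⟨e,m,X⟩,n⟩ ∈ C.
ΓAnswer : (ℕ → ℕ → ℕ → Set) → ℕ → ℕ → ℕ → Set
ΓAnswer C e′ m′ a =
  Σ[ y ∈ (ℕ → ℕ) ] (∀ k → C e′ (encodeSeq (m′ ∷ k ∷ [])) (y k)) × E y a

Γ : (ℕ → ℕ) → (ℕ → ℕ → ℕ → Set) → ℕ → ℕ → ℕ → Set
Γ X C e m n = Halts X (ΓAnswer C) e m n

data Γ∞ (X : ℕ → ℕ) (e m n : ℕ) : Set where
  fix : Γ X (Γ∞ X) e m n → Γ∞ X e m n

------------------------------------------------------------------------
-- Feedback computation

data Verdict : Set where
  ↓ ↑ : Verdict

-- How the machine receives an answer in {↓,↑}.
verdictCode : Verdict → ℕ
verdictCode ↓ = 0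
verdictCode ↑ = 1

-- `just k` is the integer k and `nothing` is the value ω.
Value : Set
Value = Maybe ℕ

-- `C e m j k` stands for C(⟨e,m,X⟩) = ⟨j,k⟩.
IAnswer : (ℕ → ℕ → Verdict → Value → Set) → ℕ → ℕ → ℕ → Set
IAnswer C e′ m′ a =
  ∃[ j′ ] ∃[ k′ ] C e′ m′ j′ k′ × a ≡ verdictCode j′

data I (X : ℕ → ℕ) (C : ℕ → ℕ → Verdict → Value → Set) (e m : ℕ) :
       Verdict → Value → Set where
  converges : ∀ {k} → Halts X (IAnswer C) e m k → I X C e m ↓ (just k)
  diverges  : RunsForever X (IAnswer C) e m → I X C e m ↑ nothing

data I∞ (X : ℕ → ℕ) (e m : ℕ) (j : Verdict) (k : Value) : Set where
  fix : I X (I∞ X) e m j k → I∞ X e m j k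

------------------------------------------------------------------------
-- Convergence and ≃

-- A partial computation is given by its graph: the predicate of converging
-- with value n.
Partial : Set₁
Partial = ℕ → Set

kleene : ℕ → ℕ → (ℕ → ℕ) → Partial
kleene e m X n = Γ∞ X e m n

feedback : ℕ → (ℕ → ℕ) → ℕ → Partial
feedback e X m n = I∞ X e m ↓ (just n)

-- For single-valued graphs this is classically the same as "both converge,
-- with the same value, or neither converges", but it does not ask for a
-- decision as to which of the two cases holds.
_≃_ : Partial → Partial → Set
P ≃ Q = ∀ n → P n ⇔ Q n

infix 4 _≃_

{-# OPTIONS --safe #-}
module Submission where

open import Defs
open import Data.Bool.Base using (Bool; true; false)
open import Data.Empty using (⊥; ⊥-elim)
open import Data.Fin.Base using (Fin)
open import Data.Fin.Patterns using (0F; 1F; 2F; 3F; 4F; 5F; 6F; 7F; 8F; 9F)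
open import Data.List.Base
  using (List; []; _∷_; drop; head; map; replicate) renaming (_++_ to _⧺_)
open import Data.List.Properties using (++-assoc; drop-map; drop-drop)
open import Data.Maybe.Base using (just; nothing)
open import Data.Nat.Base using (ℕ; zero; suc; _+_; _∸_; pred; _≤_; _<_; s≤s; z≤n)
open import Data.Nat.Properties
  using (_≟_; +-identityʳ; +-suc; +-comm; +-∸-assoc; m+n∸m≡n; m+n∸n≡m; n∸n≡0; m∸n≡0⇒m≤n;
         pred[m∸n]≡m∸[1+n]; m+n≡0⇒m≡0; m+n≡0⇒n≡0; ≤-refl; ≤-reflexive; ≤-trans; ≤-antisym;
         n≤1+n; m≤n⇒m≤1+n; m≤m+n; m≤n+m; <⇒≢; >⇒≢; ≤∧≢⇒<; <-cmp)
open import Data.Product.Base using (Σ-syntax; ∃-syntax; _×_; _,_; proj₁; proj₂)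
open import Data.Sum.Base using (_⊎_; inj₁; inj₂)
open import Data.Vec.Base using (Vec; []; _∷_; _++_; lookup)
open import Data.Vec.Relation.Binary.Pointwise.Inductive as Pointwise
  using (Pointwise; []; _∷_)
open import Function.Base using (case_of_)
open import Function.Bundles using (mk⇔)
open import Relation.Binary.Construct.Closure.ReflexiveTransitive
  using (Star; ε; _◅_; _◅◅_; gmap)
open import Relation.Binary.Definitions using (tri<; tri≈; tri>)
open import Relation.Binary.PropositionalEquality
  using (_≡_; _≢_; refl; sym; trans; cong; cong₂; subst; subst₂)
open import Relation.Nullary.Decidable.Core using (yes; no)

-- The machines K v, for v ∈ ℕ, write v on a tape and then run a fixed universal
-- interpreter of Kleene computations.  With w the index of K 0, which is started
-- on a coded state of the interpreter, k₀ e is the index of K (1 + ⟨w,e⟩), which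
-- starts the interpretation of program e on the input.  As w is kept in the state,
-- the interpreter can issue queries about itself and no recursion theorem is
-- needed.
--
-- A query Q(e′,m′) of the interpreted program is simulated by two feedback
-- queries.  The first concerns a loop asking for k = 0, 1, 2, … whether the
-- interpretation of e′ on (m′,k) converges, and halting when it does not: the loop
-- diverges iff all these computations converge, and if it does not diverge, then
-- the interpreter does not get past the query.  The second concerns the
-- same loop for a variant of the interpreter that diverges instead of halting with
-- output 0, so its answer, with ↓ received as 0 and ↑ as 1, is the value of E.

-- Primitive recursive functions with their programs

-- The danger is freezing: a feedback query about an undecided computation is never answered.
-- Because the second loop is consulted only after the first has been found to diverge, all the
-- values y(k) exist by then, and each trial of the variant has a definite verdict: convergence if
-- y(k) is positive, divergence if it is 0. This is why output 0 has to turn into genuine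
-- divergence.
--
-- Indices refer to concrete Turing tables, so an actual machine has to be built. The bookkeeping of
-- the interpreter is packed into one number with a primitive recursive update; what remains is a
-- fixed loop around one oracle instruction and one query, and a compiler from primitive recursive
-- terms to tables.
--
-- Neither inclusion decides convergence. From Kleene to feedback it is an induction on `Γ∞`,
-- conversely an induction on `I∞`. The latter uses the former together with the uniqueness of
-- verdicts: a diverging trial of the variant forces y(k) = 0, since a positive value would make
-- that trial converge.

record Fn (n : ℕ) : Set where
  field
    ⟦_⟧     : Vec ℕ n → ℕ
    code    : PR n
    correct : ∀ xs → eval code xs ≡ ⟦_⟧ xs

open Fn

applyAll : ∀ {m n} → Vec (Fn n) m → Vec ℕ n → Vec ℕ m
applyAll []       xs = []
applyAll (g ∷ gs) xs = ⟦ g ⟧ xs ∷ applyAll gs xs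

codes : ∀ {m n} → Vec (Fn n) m → Vec (PR n) m
codes []       = []
codes (g ∷ gs) = code g ∷ codes gs

codes-correct : ∀ {m n} (gs : Vec (Fn n) m) xs →
                evals (codes gs) xs ≡ applyAll gs xs
codes-correct []       xs = refl
codes-correct (g ∷ gs) xs = cong₂ _∷_ (correct g xs) (codes-correct gs xs)

infixr 9 _·_
_·_ : ∀ {m n} → Fn m → Vec (Fn n) m → Fn n
⟦ f · gs ⟧ xs     = ⟦ f ⟧ (applyAll gs xs)
code (f · gs)     = comp (code f) (codes gs)
correct (f · gs) xs =
  trans (cong (eval (code f)) (codes-correct gs xs)) (correct f _)

var : ∀ {n} → Fin n → Fn n
⟦ var i ⟧ xs     = lookup xs i
code (var i)     = proj i
correct (var i) xs = refl

succ : Fn 1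
⟦ succ ⟧ (x ∷ [])     = suc x
code succ             = sucᵖ
correct succ (x ∷ []) = refl

nat : ∀ {n} → ℕ → Fn n
⟦ nat c ⟧ _          = c
code (nat zero)      = zeroᵖ
code (nat (suc c))   = comp sucᵖ (code (nat c) ∷ [])
correct (nat zero) xs    = refl
correct (nat (suc c)) xs = cong suc (correct (nat c) xs)

primrec : ∀ {n} → (Vec ℕ n → ℕ) → (Vec ℕ (suc (suc n)) → ℕ) →
          Vec ℕ (suc n) → ℕ
primrec g h (zero  ∷ xs) = g xs
primrec g h (suc x ∷ xs) = h (x ∷ primrec g h (x ∷ xs) ∷ xs)

recursion : ∀ {n} → Fn n → Fn (suc (suc n)) → Fn (suc n)
⟦ recursion g h ⟧   = primrec ⟦ g ⟧ ⟦ h ⟧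
code (recursion g h) = rec (code g) (code h)
correct (recursion g h) (zero  ∷ xs) = correct g xs
correct (recursion g h) (suc x ∷ xs) =
  trans (cong (λ y → eval (code h) (x ∷ y ∷ xs))
              (correct (recursion g h) (x ∷ xs)))
        (correct h _)

-- Exchanges the meaning for an extensionally equal function while keeping the code, so that later
-- goals display the intended function instead of nested recursions.
computing : ∀ {n} (f : Vec ℕ n → ℕ) (F : Fn n) → (∀ xs → ⟦ F ⟧ xs ≡ f xs) → Fn n
⟦ computing f F eq ⟧      = f
code (computing f F eq)   = code F
correct (computing f F eq) xs = trans (correct F xs) (eq xs)

add : Fn 2
add = computing (λ { (x ∷ y ∷ []) → x + y })
  (recursion (var 0F) (succ · (var 1F ∷ []))) λ { (x ∷ y ∷ []) → go x y }
  where
  go : ∀ x y → primrec _ _ (x ∷ y ∷ []) ≡ x + y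
  go zero    y = refl
  go (suc x) y = cong suc (go x y)

predecessor : Fn 1
predecessor = computing (λ { (x ∷ []) → pred x })
  (recursion (nat 0) (var 0F)) λ { (zero ∷ []) → refl ; (suc x ∷ []) → refl }

monus : Fn 2
monus = computing (λ { (x ∷ y ∷ []) → x ∸ y })
  (recursion (var 0F) (predecessor · (var 1F ∷ [])) · (var 1F ∷ var 0F ∷ []))
  λ { (x ∷ y ∷ []) → go y x }
  where
  go : ∀ y x → primrec _ _ (y ∷ x ∷ []) ≡ x ∸ y
  go zero    x = refl
  go (suc y) x = trans (cong pred (go y x)) (pred[m∸n]≡m∸[1+n] x y)

ifz : ℕ → ℕ → ℕ → ℕ
ifz zero    a b = a
ifz (suc _) a b = b

ifZero : Fn 3
ifZero = computing (λ { (c ∷ a ∷ b ∷ []) → ifz c a b })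
  (recursion (var 0F) (var 3F))
  λ { (zero ∷ a ∷ b ∷ []) → refl ; (suc c ∷ a ∷ b ∷ []) → refl }

iterate : (ℕ → ℕ) → ℕ → ℕ → ℕ
iterate f zero    x = x
iterate f (suc k) x = f (iterate f k x)

iterate-comm : ∀ f k x → iterate f k (f x) ≡ f (iterate f k x)
iterate-comm f zero    x = refl
iterate-comm f (suc k) x = cong f (iterate-comm f k x)

iteration : Fn 2 → Fn 3
iteration g =
  computing (λ { (k ∷ x ∷ p ∷ []) → iterate (λ z → ⟦ g ⟧ (z ∷ p ∷ [])) k x })
  (recursion (var 0F) (g · (var 1F ∷ var 3F ∷ []))) λ { (k ∷ x ∷ p ∷ []) → go k x p }
  where
  go : ∀ k x p → primrec _ _ (k ∷ x ∷ p ∷ []) ≡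
                 iterate (λ z → ⟦ g ⟧ (z ∷ p ∷ [])) k x
  go zero    x p = refl
  go (suc k) x p = cong (λ z → ⟦ g ⟧ (z ∷ p ∷ [])) (go k x p)

-- Pairing

triangular : Fn 1
triangular = computing (λ { (x ∷ []) → triangle x })
  (recursion (nat 0) (add · (succ · (var 0F ∷ []) ∷ var 1F ∷ [])))
  λ { (x ∷ []) → go x }
  where
  go : ∀ x → primrec _ _ (x ∷ []) ≡ triangle x
  go zero    = refl
  go (suc x) = cong (suc x +_) (go x)

pairing : Fn 2
pairing = computing (λ { (x ∷ y ∷ []) → pair x y })
  (add · (triangular · (add · (var 0F ∷ var 1F ∷ []) ∷ []) ∷ var 1F ∷ []))
  λ { (x ∷ y ∷ []) → refl }

pair-next : ∀ p → pair (proj₁ (next p)) (proj₂ (next p)) ≡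
                  suc (pair (proj₁ p) (proj₂ p))
pair-next (zero  , y)
  rewrite +-identityʳ y | +-identityʳ (y + triangle y) | +-comm y (triangle y) = refl
pair-next (suc x , y) rewrite +-suc x y = +-suc _ y

pair-unpair : ∀ n → pair (π₁ n) (π₂ n) ≡ n
pair-unpair zero    = refl
pair-unpair (suc n) = trans (pair-next (unpair n)) (cong suc (pair-unpair n))

-- `unpair` recurses with pairs as values, which is not primitive recursion on numbers as it stands.
-- The number of the diagonal is a single value and determines both coordinates: `π₂` is the offset
-- on the diagonal, and `π₁` is what remains.
diagonal : ℕ → ℕ
diagonal n = π₁ n + π₂ n

n∸triangle : ∀ n → n ∸ triangle (diagonal n) ≡ π₂ n
n∸triangle n =
  trans (cong (_∸ triangle (diagonal n)) (sym (pair-unpair n)))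
        (m+n∸m≡n (triangle (diagonal n)) (π₂ n))

private
  position : ∀ {n} → Fn n → Fn n → Fn n
  position n d = monus · (n ∷ triangular · (d ∷ []) ∷ [])

-- A diagonal is left when its last point, the one with π₁ = 0, is reached.
diagonalNumber : Fn 1
diagonalNumber = computing (λ { (n ∷ []) → diagonal n })
  (recursion (nat 0)
    (ifZero · (monus · (var 1F ∷ position (var 0F) (var 1F) ∷ []) ∷
               succ · (var 1F ∷ []) ∷ var 1F ∷ [])))
  λ { (n ∷ []) → go n }
  where
  step : ∀ p → ifz (proj₁ p) (suc (proj₁ p + proj₂ p)) (proj₁ p + proj₂ p) ≡
               proj₁ (next p) + proj₂ (next p)
  step (zero  , y) = cong suc (sym (+-identityʳ y))
  step (suc x , y) = sym (+-suc x y)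
  leave : ∀ n → ifz (diagonal n ∸ (n ∸ triangle (diagonal n)))
                    (suc (diagonal n)) (diagonal n) ≡ diagonal (suc n)
  leave n rewrite n∸triangle n | m+n∸n≡m (π₁ n) (π₂ n) = step (unpair n)
  go : ∀ n → primrec _ _ (n ∷ []) ≡ diagonal n
  go zero = refl
  go (suc n) =
    trans (cong (λ d → ifz (d ∸ (n ∸ triangle d)) (suc d) d) (go n)) (leave n)

second : Fn 1
second = computing (λ { (n ∷ []) → π₂ n })
  (position (var 0F) diagonalNumber) λ { (n ∷ []) → n∸triangle n }

first : Fn 1
first = computing (λ { (n ∷ []) → π₁ n })
  (monus · (diagonalNumber ∷ second ∷ []))
  λ { (n ∷ []) → m+n∸n≡m (π₁ n) (π₂ n) }

-- Binary words, least significant digit first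

dbl : ℕ → ℕ
dbl n = n + n

parity half : ℕ → ℕ
parity zero    = 0
parity (suc n) = ifz (parity n) 1 0
half zero    = 0
half (suc n) = half n + parity n

parity-dbl : ∀ n → parity (dbl n) ≡ 0
parity-dbl zero = refl
parity-dbl (suc n) rewrite +-suc n n | parity-dbl n = refl

half-dbl : ∀ n → half (dbl n) ≡ n
half-dbl zero = refl
half-dbl (suc n)
  rewrite +-suc n n | parity-dbl n | half-dbl n | +-identityʳ n = +-comm n 1

parity-suc-dbl : ∀ n → parity (suc (dbl n)) ≡ 1
parity-suc-dbl n rewrite parity-dbl n = refl

half-suc-dbl : ∀ n → half (suc (dbl n)) ≡ n
half-suc-dbl n rewrite half-dbl n | parity-dbl n = +-identityʳ n

parityFn halfFn : Fn 1
parityFn = computing (λ { (n ∷ []) → parity n })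
  (recursion (nat 0) (ifZero · (var 1F ∷ nat 1 ∷ nat 0 ∷ [])))
  λ { (n ∷ []) → go n }
  where
  go : ∀ n → primrec _ _ (n ∷ []) ≡ parity n
  go zero    = refl
  go (suc n) = cong (λ z → ifz z 1 0) (go n)
halfFn = computing (λ { (n ∷ []) → half n })
  (recursion (nat 0) (add · (var 1F ∷ parityFn · (var 0F ∷ []) ∷ [])))
  λ { (n ∷ []) → go n }
  where
  go : ∀ n → primrec _ _ (n ∷ []) ≡ half n
  go zero    = refl
  go (suc n) = cong (_+ parity n) (go n)

double : Fn 1
double = computing (λ { (n ∷ []) → dbl n }) (add · (var 0F ∷ var 0F ∷ []))
  λ { (n ∷ []) → refl }

-- Register programs

-- `loop i c` decrements register i and runs c, until register i is zero.
data Cmd : Set where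
  skip : Cmd
  inc  : ℕ → Cmd
  _⨟_  : Cmd → Cmd → Cmd
  loop : ℕ → Cmd → Cmd

infixr 5 _⨟_

-- `assemble c b` is c as a table occupying the states from b up to `end c b`.
end : Cmd → ℕ → ℕ
end skip       b = b
end (inc i)    b = suc (suc b)
end (c ⨟ d)    b = end d (end c b)
end (loop i c) b = suc (end c (suc b))

-- One instruction tests and decrements: a positive number loses its first stroke when the head
-- erases it and moves right.
branch : (i ifZero ifPositive : ℕ) → Instruction
branch i z n = act i (action false stay z) (action false R n)

-- An unconditional jump rewrites whatever symbol is scanned on tape 0 and does not move.
jump : ℕ → Instruction
jump g = act 0 (action false stay g) (action true stay g)

-- A machine step writes before it moves, so putting a stroke in front of a block takes two states,
-- one to move left and one to write.
push₁ push₂ : (i next : ℕ) → Instruction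
push₁ i g = act i (action false L g) (action true L g)
push₂ i g = act i (action true stay g) (action true stay g)

assemble : Cmd → ℕ → Program
assemble skip       b = []
assemble (inc i)    b = push₁ i (suc b) ∷ push₂ i (suc (suc b)) ∷ []
assemble (c ⨟ d)    b = assemble c b ⧺ assemble d (end c b)
assemble (loop i c) b =
  branch i (end (loop i c) b) (suc b) ∷ assemble c (suc b) ⧺ jump b ∷ []

Regs : Set
Regs = ℕ → ℕ

-- A relation in place of an update function: assignments are only ever compared pointwise, so no
-- function extensionality is called for.
record Sets (ρ ρ′ : Regs) (i v : ℕ) : Set where
  constructor sets
  field
    here  : ρ′ i ≡ v
    there : ∀ j → j ≢ i → ρ′ j ≡ ρ j

open Sets

data Exec : Cmd → Regs → Regs → Set where
  exec-skip : ∀ {ρ} → Exec skip ρ ρ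
  exec-inc  : ∀ {i ρ ρ′} → Sets ρ ρ′ i (suc (ρ i)) → Exec (inc i) ρ ρ′
  exec-seq  : ∀ {c d ρ ρ₁ ρ₂} → Exec c ρ ρ₁ → Exec d ρ₁ ρ₂ → Exec (c ⨟ d) ρ ρ₂
  exec-done : ∀ {i c ρ} → ρ i ≡ 0 → Exec (loop i c) ρ ρ
  exec-loop : ∀ {i c n ρ ρ₀ ρ₁ ρ₂} → ρ i ≡ suc n → Sets ρ ρ₀ i n →
              Exec c ρ₀ ρ₁ → Exec (loop i c) ρ₁ ρ₂ → Exec (loop i c) ρ ρ₂

set : Regs → ℕ → ℕ → Regs
set ρ i v j with j ≟ i
... | yes _ = v
... | no  _ = ρ j

set-sets : ∀ ρ i v → Sets ρ (set ρ i v) i v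
set-sets ρ i v .here with i ≟ i
... | yes _  = refl
... | no i≢i = ⊥-elim (i≢i refl)
set-sets ρ i v .there j j≢i with j ≟ i
... | yes j≡i = ⊥-elim (j≢i j≡i)
... | no _    = refl

-- The invariant is indexed by the value of the loop counter, so termination is induction on that
-- index. The body starts from the decremented counter, because the test and the decrement are one
-- instruction.
exec-while : ∀ {i c} (P : ℕ → Regs → Set) → (∀ {n ρ} → P n ρ → ρ i ≡ n) →
             (∀ {n ρ ρ₀} → P (suc n) ρ → Sets ρ ρ₀ i n →
              ∃[ ρ₁ ] Exec c ρ₀ ρ₁ × P n ρ₁) →
             ∀ n {ρ} → P n ρ → ∃[ ρ′ ] Exec (loop i c) ρ ρ′ × P 0 ρ′
exec-while P counter body zero    {ρ} p = ρ , exec-done (counter p) , p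
exec-while {i} P counter body (suc n) {ρ} p
  with _ , x , q ← body p (set-sets ρ i n)
  with _ , y , r ← exec-while P counter body n q =
  _ , exec-loop (counter p) (set-sets ρ i n) x y , r

-- Register programs as machines

Tapes : Set
Tapes = ℕ → Tape

registers : Tapes → Regs
registers T i = number (T i)

≔-sets : ∀ T i t → Sets (registers T) (registers (T [ i ≔ t ])) i (number t)
≔-sets T i t .here with i ≟ i
... | yes _  = refl
... | no i≢i = ⊥-elim (i≢i refl)
≔-sets T i t .there j j≢i with j ≟ i
... | yes j≡i = ⊥-elim (j≢i j≡i)
... | no _    = refl

≔-same : ∀ (T : Tapes) i t → (T [ i ≔ t ]) i ≡ t
≔-same T i t with i ≟ i
... | yes _  = refl
... | no i≢i = ⊥-elim (i≢i refl)

Sets-same : ∀ {ρ ρ′ : Regs} {i} → Sets ρ ρ′ i (ρ i) → ∀ j → ρ′ j ≡ ρ j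
Sets-same {i = i} s j with j ≟ i
... | yes refl = s .here
... | no j≢i   = s .there j j≢i

Sets-resp : ∀ {ρ ρ′ σ σ′ : Regs} {i v} → (∀ j → σ j ≡ ρ j) →
            Sets ρ ρ′ i v → Sets σ σ′ i v → ∀ j → σ′ j ≡ ρ′ j
Sets-resp {i = i} eq s t j with j ≟ i
... | yes refl = trans (t .here) (sym (s .here))
... | no j≢i   = trans (t .there j j≢i) (trans (eq j) (sym (s .there j j≢i)))

drop-suc : ∀ {A : Set} b {xs : List A} {y ys} → drop b xs ≡ y ∷ ys → drop (suc b) xs ≡ ys
drop-suc zero    {x ∷ xs} refl = refl
drop-suc (suc b) {x ∷ xs} eq   = drop-suc b {xs} eq

step-fetch : ∀ {X A p c c₁} → Step X A p c c₁ → fetch p (Config.state c) ≢ nothing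
step-fetch (act-step f)     g with () ← trans (sym f) g
step-fetch (oracle-step f)  g with () ← trans (sym f) g
step-fetch (query-step f _) g with () ← trans (sym f) g

module Machine (X : ℕ → ℕ) (p : Program) where

  -- With the empty answer relation no query step is possible. Such runs are therefore forced, and
  -- they are runs for every answer relation.
  Silent : Config → Config → Set
  Silent = Star (Step X (λ _ _ _ → ⊥) p)

  drop-fetch : ∀ b {c xs} → drop b p ≡ c ∷ xs → fetch p b ≡ just c
  drop-fetch b eq = cong head eq

  drop-next : ∀ b {c xs} → drop b p ≡ c ∷ xs → drop (suc b) p ≡ xs
  drop-next b = drop-suc b {p}

  drop-end : ∀ c {b xs} → drop b p ≡ assemble c b ⧺ xs → drop (end c b) p ≡ xs
  drop-end skip    eq = eq
  drop-end (inc i) {b} eq = drop-next (suc b) (drop-next b eq)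
  drop-end (c ⨟ d) {b} eq =
    drop-end d (drop-end c (trans eq (++-assoc (assemble c b) _ _)))
  drop-end (loop i c) {b} eq =
    drop-next (end c (suc b))
      (drop-end c (trans (drop-next b eq) (++-assoc (assemble c (suc b)) _ _)))

  module _ {A : ℕ → ℕ → ℕ → Set} where

    act-on : ∀ {q T i a₀ a₁} t → T i ≡ t → fetch p q ≡ just (act i a₀ a₁) →
             let a = choose (scanned t) a₀ a₁ in
             Step X A p (config q T)
               (config (Action.goto a)
                 (T [ i ≔ move (Action.direction a) (write (Action.symbol a) t) ]))
    act-on t refl f = act-step f

    -- Writing a blank may turn an implicit blank cell into an explicit one, so the tapes themselves
    -- can change; the numbers on them do not.
    branch-zero : ∀ {q T i z n} → fetch p q ≡ just (branch i z n) →
                  number (T i) ≡ 0 →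
                  ∃[ T′ ] Step X A p (config q T) (config z T′) ×
                          ∀ j → number (T′ j) ≡ number (T j)
    branch-zero {T = T} {i} f eq with T i in Ti
    ... | tape l [] =
      _ , act-on _ Ti f ,
      Sets-same (subst (Sets _ _ i) (sym (cong number Ti)) (≔-sets T i _))
    ... | tape l (false ∷ r) =
      _ , act-on _ Ti f ,
      Sets-same (subst (Sets _ _ i) (sym (cong number Ti)) (≔-sets T i _))

    branch-suc : ∀ {q T i z n k} → fetch p q ≡ just (branch i z n) →
                 number (T i) ≡ suc k →
                 ∃[ T′ ] Step X A p (config q T) (config n T′) ×
                         Sets (registers T) (registers T′) i k
    branch-suc {T = T} {i} f eq with T i in Ti
    branch-suc {T = T} {i} f refl | tape l (true ∷ r) =
      _ , act-on _ Ti f , ≔-sets T i _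

    jump-step : ∀ {q T g} → fetch p q ≡ just (jump g) →
                ∃[ T′ ] Step X A p (config q T) (config g T′) ×
                        ∀ j → number (T′ j) ≡ number (T j)
    jump-step {T = T} f with T 0 in T0
    ... | tape l [] =
      _ , act-on _ T0 f ,
      Sets-same (subst (Sets _ _ 0) (sym (cong number T0)) (≔-sets T 0 _))
    ... | tape l (false ∷ r) =
      _ , act-on _ T0 f ,
      Sets-same (subst (Sets _ _ 0) (sym (cong number T0)) (≔-sets T 0 _))
    ... | tape l (true ∷ r) =
      _ , act-on _ T0 f ,
      Sets-same (subst (Sets _ _ 0) (sym (cong number T0)) (≔-sets T 0 _))

    push₁-step : ∀ {q T i g} → fetch p q ≡ just (push₁ i g) →
                 Step X A p (config q T)
                   (config g (T [ i ≔ move L (write (scanned (T i)) (T i)) ]))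
    push₁-step {T = T} {i} f with T i in Ti
    ... | tape l []          = act-on _ Ti f
    ... | tape l (false ∷ r) = act-on _ Ti f
    ... | tape l (true ∷ r)  = act-on _ Ti f

    push₂-step : ∀ {q T i g} t → T i ≡ t → fetch p q ≡ just (push₂ i g) →
                 Step X A p (config q T) (config g (T [ i ≔ write true t ]))
    push₂-step t@(tape l [])          eq f = act-on t eq f
    push₂-step t@(tape l (false ∷ r)) eq f = act-on t eq f
    push₂-step t@(tape l (true ∷ r))  eq f = act-on t eq f

  number-pushed : ∀ t → number (write true (move L (write (scanned t) t))) ≡ suc (number t)
  number-pushed (tape []      [])          = refl
  number-pushed (tape []      (false ∷ r)) = refl
  number-pushed (tape []      (true ∷ r))  = refl
  number-pushed (tape (_ ∷ l) [])          = refl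
  number-pushed (tape (_ ∷ l) (false ∷ r)) = refl
  number-pushed (tape (_ ∷ l) (true ∷ r))  = refl

  simulate : ∀ {c ρ ρ′} → Exec c ρ ρ′ → ∀ {T b xs} →
             (∀ j → number (T j) ≡ ρ j) → drop b p ≡ assemble c b ⧺ xs →
             ∃[ T′ ] Silent (config b T) (config (end c b) T′) ×
                     ∀ j → number (T′ j) ≡ ρ′ j
  simulate exec-skip eq d = _ , ε , eq
  simulate (exec-inc {i} s) {T} {b} eq d =
    _ , push₁-step (drop-fetch b d) ◅
        push₂-step _ (≔-same T i _) (drop-fetch (suc b) (drop-next b d)) ◅ ε ,
    Sets-resp eq s
      (sets (trans (≔-sets T₁ i _ .here) (trans (number-pushed (T i)) (cong suc (eq i))))
            (λ j j≢i → trans (≔-sets T₁ i _ .there j j≢i) (≔-sets T i _ .there j j≢i)))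
    where T₁ = T [ i ≔ move L (write (scanned (T i)) (T i)) ]
  simulate (exec-seq {c} x y) {b = b} eq d
    with d′ ← trans d (++-assoc (assemble c b) _ _)
    with _ , r , eq₁ ← simulate x eq d′
    with _ , s , eq₂ ← simulate y eq₁ (drop-end c d′) = _ , r ◅◅ s , eq₂
  simulate (exec-done z) {b = b} eq d
    with _ , r , eq₁ ← branch-zero (drop-fetch b d) (trans (eq _) z) =
    _ , r ◅ ε , λ j → trans (eq₁ j) (eq j)
  simulate (exec-loop {i} {c} z s x y) {b = b} eq d
    with _ , r , t ← branch-suc (drop-fetch b d) (trans (eq _) z)
    with d′ ← trans (drop-next b d) (++-assoc (assemble c (suc b)) _ _)
    with _ , u , eq₁ ← simulate x (Sets-resp eq s t) d′
    with _ , v , eq₂ ← jump-step (drop-fetch (end c (suc b)) (drop-end c d′))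
    with _ , w , eq₃ ← simulate y (λ j → trans (eq₂ j) (eq₁ j)) d =
    _ , r ◅ u ◅◅ v ◅ w , eq₃

-- Basic register commands

Sets-trans : ∀ {ρ σ τ i m n} → Sets ρ σ i m → Sets σ τ i n → Sets ρ τ i n
Sets-trans s t = sets (t .here) λ j j≢i → trans (t .there j j≢i) (s .there j j≢i)

Sets-refl : ∀ {ρ i} → Sets ρ ρ i (ρ i)
Sets-refl = sets refl λ _ _ → refl

inc-spec : ∀ i ρ → ∃[ ρ′ ] Exec (inc i) ρ ρ′ × Sets ρ ρ′ i (suc (ρ i))
inc-spec i ρ = _ , exec-inc (set-sets ρ i _) , set-sets ρ i _

clear : ℕ → Cmd
clear i = loop i skip

clear-spec : ∀ i ρ → ∃[ ρ′ ] Exec (clear i) ρ ρ′ × Sets ρ ρ′ i 0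
clear-spec i ρ = exec-while (λ n σ → Sets ρ σ i n) here
  (λ s t → _ , exec-skip , Sets-trans s t) (ρ i) Sets-refl

transfer : (from to : ℕ) → Cmd
transfer i j = loop i (inc j)

record Transfers (ρ ρ′ : Regs) (i j : ℕ) : Set where
  constructor transfers
  field
    source : ρ′ i ≡ 0
    target : ρ′ j ≡ ρ i + ρ j
    others : ∀ k → k ≢ i → k ≢ j → ρ′ k ≡ ρ k

open Transfers

transfer-spec : ∀ {i j} ρ → i ≢ j →
                ∃[ ρ′ ] Exec (transfer i j) ρ ρ′ × Transfers ρ ρ′ i j
transfer-spec {i} {j} ρ i≢j
  with _ , x , s , t , o ← exec-while
    (λ n σ → σ i ≡ n × n + σ j ≡ ρ i + ρ j × ∀ k → k ≢ i → k ≢ j → σ k ≡ ρ k) proj₁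
    (λ { {n} (s , t , o) u →
         let (_ , x , v) = inc-spec j _ in
         _ , x ,
         trans (v .there i i≢j) (u .here) ,
         trans (cong (n +_) (trans (v .here)
           (cong suc (u .there j λ e → i≢j (sym e))))) (trans (+-suc n _) t) ,
         λ k k≢i k≢j → trans (v .there k k≢j) (trans (u .there k k≢i) (o k k≢i k≢j)) })
    (ρ i) {ρ} (refl , refl , λ _ _ _ → refl) =
  _ , x , transfers s t o

-- The register t is scratch space.
copy : (from to t : ℕ) → Cmd
copy i j t = loop i (inc j ⨟ inc t) ⨟ transfer t i

copy-spec : ∀ {i j t} ρ → i ≢ j → i ≢ t → j ≢ t → ρ t ≡ 0 →
            ∃[ ρ′ ] Exec (copy i j t) ρ ρ′ × Sets ρ ρ′ j (ρ i + ρ j)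
copy-spec {i} {j} {t} ρ i≢j i≢t j≢t z
  with ρ₁ , x , ri , rj , rt , ro ← exec-while
    (λ n σ → σ i ≡ n × n + σ j ≡ ρ i + ρ j × n + σ t ≡ ρ i ×
             ∀ k → k ≢ i → k ≢ j → k ≢ t → σ k ≡ ρ k) proj₁
    (λ { {n} (ri , rj , rt , ro) u →
         let (_ , x , v) = inc-spec j _
             (_ , y , w) = inc-spec t _ in
         _ , exec-seq x y ,
         trans (w .there i i≢t) (trans (v .there i i≢j) (u .here)) ,
         trans (cong (n +_) (trans (w .there j j≢t) (trans (v .here)
           (cong suc (u .there j λ e → i≢j (sym e)))))) (trans (+-suc n _) rj) ,
         trans (cong (n +_) (trans (w .here) (cong suc
           (trans (v .there t λ e → j≢t (sym e)) (u .there t λ e → i≢t (sym e))))))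
           (trans (+-suc n _) rt) ,
         λ k k≢i k≢j k≢t → trans (w .there k k≢t) (trans (v .there k k≢j)
           (trans (u .there k k≢i) (ro k k≢i k≢j k≢t))) })
    (ρ i) {ρ} (refl , refl , trans (cong (ρ i +_) z) (+-identityʳ _) , λ _ _ _ _ → refl)
  with ρ₂ , y , T ← transfer-spec {t} {i} _ (λ e → i≢t (sym e)) =
  ρ₂ , exec-seq x y ,
  sets (trans (T .others j j≢t λ e → i≢j (sym e)) rj) rest
  where
  rest : ∀ k → k ≢ j → ρ₂ k ≡ ρ k
  rest k k≢j with k ≟ i | k ≟ t
  ... | yes refl | _ = trans (T .target) (trans (cong (ρ₁ t +_) ri) (trans (+-identityʳ _) rt))
  ... | no _   | yes refl = trans (T .source) (sym z)
  ... | no k≢i | no k≢t   = trans (T .others k k≢t k≢i) (ro k k≢i k≢j k≢t)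

-- Registers as a stack

Below : ℕ → Regs → Regs → Set
Below s ρ ρ′ = ∀ j → j < s → ρ′ j ≡ ρ j

-- The empty case demands zeros from `s` on. Everything above the stack is thus clean, as `copy` and
-- `transfer` require: they add to their target instead of overwriting it.
Stored : ∀ {m} → ℕ → Vec ℕ m → Regs → Set
Stored s []       ρ = ∀ j → s ≤ j → ρ j ≡ 0
Stored s (v ∷ vs) ρ = ρ s ≡ v × Stored (suc s) vs ρ

-- This is s + m, with an accumulator so that it unfolds in step with `Stored` and `range`.
top : ℕ → ℕ → ℕ
top s zero    = s
top s (suc m) = top (suc s) m

≤-top : ∀ s m → s ≤ top s m
≤-top s zero    = ≤-refl
≤-top s (suc m) = ≤-trans (n≤1+n s) (≤-top (suc s) m)

Stored-top : ∀ {m} s (vs : Vec ℕ m) {ρ} → Stored s vs ρ → Stored (top s m) [] ρ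
Stored-top s []       st       = st
Stored-top s (_ ∷ vs) (_ , st) = Stored-top (suc s) vs st

Stored-resp : ∀ {m} s (vs : Vec ℕ m) {ρ ρ′} →
              (∀ j → s ≤ j → ρ′ j ≡ ρ j) → Stored s vs ρ → Stored s vs ρ′
Stored-resp s []       eq st       j s≤j = trans (eq j s≤j) (st j s≤j)
Stored-resp s (_ ∷ vs) eq (e , st) =
  trans (eq s ≤-refl) e ,
  Stored-resp (suc s) vs (λ j s<j → eq j (≤-trans (n≤1+n s) s<j)) st

Stored-sets : ∀ {m} s (vs : Vec ℕ m) {ρ ρ′ i v} → i < s → Sets ρ ρ′ i v →
              Stored s vs ρ → Stored s vs ρ′
Stored-sets s vs i<s t = Stored-resp s vs λ j s≤j → t .there j (>⇒≢ (≤-trans i<s s≤j))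

Stored-suc : ∀ {s ρ} → Stored s [] ρ → Stored (suc s) [] ρ
Stored-suc st j s<j = st j (≤-trans (n≤1+n _) s<j)

Stored-replace : ∀ {s ρ} → ρ s ≡ 0 → Stored (suc s) [] ρ → Stored s [] ρ
Stored-replace {s} e st j s≤j with j ≟ s
... | yes refl = e
... | no j≢s   = st j (≤∧≢⇒< s≤j λ e → j≢s (sym e))

Below-sets : ∀ {s ρ ρ′ i v} → s ≤ i → Sets ρ ρ′ i v → Below s ρ ρ′
Below-sets s≤i t j j<s = t .there j (<⇒≢ (≤-trans j<s s≤i))

Below-trans : ∀ {s ρ σ τ} → Below s ρ σ → Below s σ τ → Below s ρ τ
Below-trans b c j j<s = trans (c j j<s) (b j j<s)

Below-≤ : ∀ {s s′ ρ ρ′} → s ≤ s′ → Below s′ ρ ρ′ → Below s ρ ρ′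
Below-≤ s≤s′ b j j<s = b j (≤-trans j<s s≤s′)

Holds : ∀ {n} → Regs → ℕ → Vec ℕ n → Vec ℕ n → Set
Holds ρ s = Pointwise (λ i x → i < s × ρ i ≡ x)

Holds-weaken : ∀ {n ρ ρ′ s s′} {is xs : Vec ℕ n} → s ≤ s′ → Below s ρ ρ′ →
               Holds ρ s is xs → Holds ρ′ s′ is xs
Holds-weaken s≤s′ b =
  Pointwise.map λ (i<s , e) → ≤-trans i<s s≤s′ , trans (b _ i<s) e

range : ℕ → (m : ℕ) → Vec ℕ m
range s zero    = []
range s (suc m) = s ∷ range (suc s) m

Stored-range : ∀ {m} s (vs : Vec ℕ m) {ρ} → Stored s vs ρ →
               Holds ρ (top s m) (range s m) vs
Stored-range s []       st       = []
Stored-range {suc m} s (_ ∷ vs) (e , st) =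
  (≤-top (suc s) m , e) ∷ Stored-range (suc s) vs st

clearAll : ℕ → ℕ → Cmd
clearAll s zero    = skip
clearAll s (suc m) = clear s ⨟ clearAll (suc s) m

clearAll-spec : ∀ {m} s (vs : Vec ℕ m) {ρ} → Stored s vs ρ →
                ∃[ ρ′ ] Exec (clearAll s m) ρ ρ′ × Below s ρ ρ′ × Stored s [] ρ′
clearAll-spec s []       st = _ , exec-skip , (λ _ _ → refl) , st
clearAll-spec s (v ∷ vs) {ρ} (_ , st)
  with _ , x , t ← clear-spec s ρ
  with _ , y , b , st′ ← clearAll-spec (suc s) vs (Stored-sets (suc s) vs ≤-refl t st) =
  _ , exec-seq x y ,
  Below-trans (Below-sets ≤-refl t) (Below-≤ (n≤1+n s) b) ,
  Stored-replace (trans (b s ≤-refl) (t .here)) st′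

-- Compilation of primitive recursive functions

mutual
  -- The value is left in register s, with the registers above s as scratch space.
  compute : ∀ {n} → PR n → Vec ℕ n → ℕ → Cmd
  compute zeroᵖ       is       s = skip
  compute sucᵖ        (i ∷ []) s = copy i s (suc s) ⨟ inc s
  compute (proj k)    is       s = copy (lookup is k) s (suc s)
  compute (comp {m} f gs) is   s =
    computeAll gs is (suc s) ⨟
    compute f (range (suc s) m) (top (suc s) m) ⨟
    transfer (top (suc s) m) s ⨟
    clearAll (suc s) m
  -- Register `s` counts down, `1 + s` counts up, `2 + s` holds the value at the current count, and
  -- `3 + s` receives the next value.
  compute (rec g h)   (i ∷ is) s =
    copy i s (suc s) ⨟
    compute g is (2 + s) ⨟
    loop s (compute h (1 + s ∷ 2 + s ∷ is) (3 + s) ⨟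
            clear (2 + s) ⨟ transfer (3 + s) (2 + s) ⨟ inc (1 + s)) ⨟
    transfer (2 + s) s ⨟
    clear (1 + s)

  computeAll : ∀ {m n} → Vec (PR n) m → Vec ℕ n → ℕ → Cmd
  computeAll []       is s = skip
  computeAll (g ∷ gs) is s = compute g is s ⨟ computeAll gs is (suc s)

Pushes : ∀ {m} → Cmd → ℕ → Vec ℕ m → Regs → Set
Pushes c s vs ρ = ∃[ ρ′ ] Exec c ρ ρ′ × Below s ρ ρ′ × Stored s vs ρ′

copy-pushes : ∀ {i s ρ} → i < s → Stored s [] ρ → Pushes (copy i s (suc s)) s (ρ i ∷ []) ρ
copy-pushes {i} {s} {ρ} i<s st
  with _ , x , t ← copy-spec ρ (<⇒≢ i<s) (<⇒≢ (m≤n⇒m≤1+n i<s)) (<⇒≢ ≤-refl)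
                             (st (suc s) (n≤1+n s)) =
  _ , x , Below-sets ≤-refl t ,
  trans (t .here) (trans (cong (ρ i +_) (st s ≤-refl)) (+-identityʳ _)) ,
  Stored-sets (suc s) [] ≤-refl t (Stored-suc st)

-- Moving the result out of register `t` leaves a zero there, so above `s` the registers look as
-- they did before the result was computed. In a composition, the intermediate arguments are thus
-- still in place to be cleared.
popped : ∀ {a s t ρ₁ ρ₂ ρ₃} → s < a → Below t ρ₁ ρ₂ → Stored t [] ρ₁ →
         Stored (suc t) [] ρ₂ → Transfers ρ₂ ρ₃ t s → ∀ j → a ≤ j → ρ₃ j ≡ ρ₁ j
popped {t = t} s<a b st₁ st₂ T j a≤j with <-cmp j t
... | tri< j<t _ _  = trans (T .others j (<⇒≢ j<t) (>⇒≢ (≤-trans s<a a≤j))) (b j j<t)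
... | tri≈ _ refl _ = trans (T .source) (sym (st₁ t ≤-refl))
... | tri> _ _ t<j  = trans (T .others j (>⇒≢ t<j) (>⇒≢ (≤-trans s<a a≤j)))
                            (trans (st₂ j t<j) (sym (st₁ j (≤-trans (n≤1+n t) t<j))))

-- When the countdown has reached 0, `total` identifies `current` with `x`, and `value` is then the
-- value sought.
record LoopState (f : ℕ → ℕ) (s x : ℕ) (ρ : Regs) (n : ℕ) (σ : Regs) : Set where
  field
    current   : ℕ
    countdown : σ s ≡ n
    counter   : σ (1 + s) ≡ current
    value     : σ (2 + s) ≡ f current
    total     : n + current ≡ x
    below     : Below s ρ σ
    scratch   : Stored (3 + s) [] σ

open LoopState

loop-body : ∀ {f s x ρ c} →
  (∀ k {τ} → Below s ρ τ → τ (1 + s) ≡ k → τ (2 + s) ≡ f k → Stored (3 + s) [] τ →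
   Pushes c (3 + s) (f (suc k) ∷ []) τ) →
  ∀ {n σ σ₀} → LoopState f s x ρ (suc n) σ → Sets σ σ₀ s n →
  ∃[ σ₁ ] Exec (c ⨟ clear (2 + s) ⨟ transfer (3 + s) (2 + s) ⨟ inc (1 + s)) σ₀ σ₁ ×
          LoopState f s x ρ n σ₁
loop-body {f} {s} step {n} {σ} {σ₀} ls u
  with σ₁ , c₁ , b₁ , e₁ , st₁ ← step (ls .current)
         (Below-trans (ls .below) (Below-sets ≤-refl u))
         (trans (u .there (1 + s) (>⇒≢ ≤-refl)) (ls .counter))
         (trans (u .there (2 + s) (>⇒≢ (n≤1+n _))) (ls .value))
         (Stored-sets (3 + s) [] (m≤n⇒m≤1+n (n≤1+n _)) u (ls .scratch))
  with σ₂ , c₂ , t ← clear-spec (2 + s) σ₁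
  with σ₃ , c₃ , T ← transfer-spec {3 + s} {2 + s} σ₂ (>⇒≢ ≤-refl)
  with σ₄ , c₄ , v ← inc-spec (1 + s) σ₃ =
  σ₄ , exec-seq c₁ (exec-seq c₂ (exec-seq c₃ c₄)) , record
    { current   = suc (ls .current)
    ; countdown = trans (v .there s (<⇒≢ ≤-refl)) (trans (low s (n≤1+n _)) (u .here))
    ; counter   = trans (v .here) (cong suc (trans (low (1 + s) ≤-refl)
                    (trans (u .there (1 + s) (>⇒≢ ≤-refl)) (ls .counter))))
    ; value     = trans (v .there (2 + s) (>⇒≢ ≤-refl)) (trans (T .target)
                    (trans (cong₂ _+_ (trans (t .there (3 + s) (>⇒≢ ≤-refl)) e₁) (t .here))
                           (+-identityʳ _)))
    ; total     = trans (+-suc n _) (ls .total)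
    ; below     = λ j j<s → trans (v .there j (<⇒≢ (m≤n⇒m≤1+n j<s)))
                    (trans (low j (m≤n⇒m≤1+n (m≤n⇒m≤1+n j<s)))
                      (trans (u .there j (<⇒≢ j<s)) (ls .below j j<s)))
    ; scratch   = Stored-sets (3 + s) [] (n≤1+n _) v (Stored-replace (T .source)
                    (Stored-resp (4 + s) [] (λ j l → T .others j (>⇒≢ l) (>⇒≢ (≤-trans (n≤1+n _) l)))
                      (Stored-sets (4 + s) [] (n≤1+n _) t st₁))) }
  where
  low : ∀ j → j < 2 + s → _ ≡ σ₀ j
  low j l = trans (T .others j (<⇒≢ (m≤n⇒m≤1+n l)) (<⇒≢ l))
                  (trans (t .there j (<⇒≢ l)) (b₁ j (m≤n⇒m≤1+n l)))

mutual
  compute-spec : ∀ {n} (p : PR n) {is xs : Vec ℕ n} {s ρ} → Holds ρ s is xs →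
                 Stored s [] ρ → Pushes (compute p is s) s (eval p xs ∷ []) ρ
  compute-spec zeroᵖ hs st =
    _ , exec-skip , (λ _ _ → refl) , st _ ≤-refl , Stored-suc st
  compute-spec sucᵖ {s = s} ((i<s , e) ∷ []) st
    with _ , x , b , e₁ , st₁ ← copy-pushes i<s st
    with _ , y , t ← inc-spec s _ =
    _ , exec-seq x y , Below-trans b (Below-sets ≤-refl t) ,
    trans (t .here) (cong suc (trans e₁ e)) , Stored-sets (suc s) [] ≤-refl t st₁
  compute-spec (proj k) hs st
    with i<s , e ← Pointwise.lookup hs k
    with _ , x , b , e₁ , st₁ ← copy-pushes i<s st = _ , x , b , trans e₁ e , st₁
  compute-spec (comp {m} f gs) {xs = xs} {s} hs st
    with ρ₁ , x , b₁ , st₁ ← computeAll-spec gs (Holds-weaken (n≤1+n s) (λ _ _ → refl) hs)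
                               (Stored-suc st)
    with ρ₂ , y , b₂ , e₂ , st₂ ← compute-spec f (Stored-range (suc s) _ st₁)
                                    (Stored-top (suc s) _ st₁)
    with ρ₃ , z , T ← transfer-spec ρ₂ (>⇒≢ (≤-top (suc s) m))
    with _ , w , b₄ , st₄ ← clearAll-spec (suc s) _
           (Stored-resp (suc s) _ (popped ≤-refl b₂ (Stored-top (suc s) _ st₁) st₂ T) st₁) =
    _ , exec-seq x (exec-seq y (exec-seq z w)) ,
    Below-trans (Below-trans (Below-≤ (n≤1+n s) b₁) (Below-≤ (≤-trans (n≤1+n s) (≤-top (suc s) m)) b₂))
      (Below-trans (λ j j<s → T .others j
                      (<⇒≢ (≤-trans j<s (≤-trans (n≤1+n s) (≤-top (suc s) m)))) (<⇒≢ j<s))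
                   (Below-≤ (n≤1+n s) b₄)) ,
    trans (b₄ s ≤-refl) (trans (T .target) (trans (cong₂ _+_ e₂
      (trans (b₂ s (≤-top (suc s) m)) (trans (b₁ s ≤-refl) (st s ≤-refl)))) (+-identityʳ _))) ,
    st₄
  compute-spec (rec g h) {i ∷ is} {x ∷ xs} {s} ((i<s , e) ∷ hs) st
    with ρ₁ , c₁ , b₁ , e₁ , st₁ ← copy-pushes i<s st
    with ρ₂ , c₂ , b₂ , e₂ , st₂ ←
           compute-spec g (Holds-weaken (m≤n⇒m≤1+n (n≤1+n s)) b₁ hs) (Stored-suc st₁)
    with hs₂ ← Holds-weaken (m≤n⇒m≤1+n (n≤1+n s)) b₁ hs
    with ρ₂ , c₂ , b₂ , e₂ , st₂ ← compute-spec g hs₂ (Stored-suc st₁)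
    with σ , c₃ , ls ← exec-while (LoopState (λ k → eval (rec g h) (k ∷ xs)) s x ρ₁) countdown
           (loop-body λ k b e₁ e₂ st → compute-spec h
             ((s≤s (n≤1+n _) , e₁) ∷ (≤-refl , e₂) ∷
               Holds-weaken (m≤n⇒m≤1+n (m≤n⇒m≤1+n (n≤1+n s)))
                 b (Holds-weaken ≤-refl b₁ hs)) st)
           x {ρ₂} (record
             { current   = 0
             ; countdown = trans (b₂ s (n≤1+n _)) (trans e₁ e)
             ; counter   = trans (b₂ (suc s) ≤-refl) (st₁ (suc s) ≤-refl)
             ; value     = e₂
             ; total     = +-identityʳ x
             ; below     = Below-≤ (m≤n⇒m≤1+n (n≤1+n s)) b₂
             ; scratch   = st₂ })
    with σ₁ , c₄ , T ← transfer-spec σ (>⇒≢ (n≤1+n (suc s)))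
    with _ , c₅ , t ← clear-spec (suc s) σ₁ =
    _ , exec-seq c₁ (exec-seq c₂ (exec-seq c₃ (exec-seq c₄ c₅))) ,
    (λ j j<s → trans (t .there j (<⇒≢ (m≤n⇒m≤1+n j<s)))
      (trans (T .others j (<⇒≢ (m≤n⇒m≤1+n (m≤n⇒m≤1+n j<s))) (<⇒≢ j<s))
        (trans (ls .below j j<s) (b₁ j j<s)))) ,
    trans (t .there s (<⇒≢ ≤-refl)) (trans (T .target)
      (trans (cong₂ _+_ (ls .value) (ls .countdown))
        (trans (+-identityʳ _) (cong (λ k → eval (rec g h) (k ∷ xs)) (ls .total))))) ,
    Stored-replace (t .here) (Stored-sets (2 + s) [] ≤-refl t
      (Stored-replace (T .source) (Stored-resp (3 + s) []
        (λ j l → T .others j (>⇒≢ l) (>⇒≢ (≤-trans (m≤n⇒m≤1+n (n≤1+n _)) l))) (ls .scratch))))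

  computeAll-spec : ∀ {m n} (gs : Vec (PR n) m) {is xs : Vec ℕ n} {s ρ} → Holds ρ s is xs →
                    Stored s [] ρ → Pushes (computeAll gs is s) s (evals gs xs) ρ
  computeAll-spec []       hs st = _ , exec-skip , (λ _ _ → refl) , st
  computeAll-spec (g ∷ gs) {s = s} hs st
    with _ , x , b , e , st₁ ← compute-spec g hs st
    with _ , y , b₁ , st₂ ← computeAll-spec gs (Holds-weaken (n≤1+n s) b hs) st₁ =
    _ , exec-seq x y , Below-trans b (Below-≤ (n≤1+n s) b₁) ,
    trans (b₁ s ≤-refl) e , st₂

Stored-++ : ∀ {m n} s (vs : Vec ℕ m) {ws : Vec ℕ n} {ρ ρ′} → Below (top s m) ρ ρ′ →
            Stored s vs ρ → Stored (top s m) ws ρ′ → Stored s (vs ++ ws) ρ′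
Stored-++         s []       b st       st′ = st′
Stored-++ {suc m} s (_ ∷ vs) b (e , st) st′ =
  trans (b s (≤-top (suc s) m)) e , Stored-++ (suc s) vs b st st′

call : ∀ {n} → Fn n → Vec ℕ n → ℕ → Cmd
call f = compute (code f)

call-spec : ∀ {m n} (f : Fn n) {is xs : Vec ℕ n} (vs : Vec ℕ m) {ρ} →
            Stored 0 vs ρ → Holds ρ (top 0 m) is xs →
            ∃[ ρ′ ] Exec (call f is (top 0 m)) ρ ρ′ × Stored 0 (vs ++ ⟦ f ⟧ xs ∷ []) ρ′
call-spec f {xs = xs} vs st hs
  with _ , x , b , e , st′ ← compute-spec (code f) hs (Stored-top 0 vs st) =
  _ , x , Stored-++ 0 vs b st (trans e (correct f xs) , st′)

-- Machines iterating a primitive recursive function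

incs : ℕ → Cmd
incs zero    = skip
incs (suc v) = inc 1 ⨟ incs v

incs-spec : ∀ v {m k ρ} → Stored 0 (m ∷ k ∷ []) ρ →
            ∃[ ρ′ ] Exec (incs v) ρ ρ′ × Stored 0 (m ∷ v + k ∷ []) ρ′
incs-spec zero    st = _ , exec-skip , st
incs-spec (suc v) {m} {k} {ρ} (e₀ , e₁ , st)
  with ρ₁ , x , t ← inc-spec 1 ρ
  with ρ₂ , y , f₀ , f₁ , st₂ ← incs-spec v {m} {suc k}
         ( trans (t .there 0 (λ ())) e₀ , trans (t .here) (cong suc e₁)
         , Stored-sets 2 [] ≤-refl t st) =
  ρ₂ , exec-seq x y , f₀ , trans f₁ (+-suc v k) , st₂

number-numeral : ∀ n → number (numeral n) ≡ n
number-numeral zero    = refl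
number-numeral (suc n) = cong suc (number-numeral n)

-- A machine iterating a function on numbers that may ask the oracle and issue
-- queries: kind s = 0 halts with output arg s, kind s = 1 passes X (arg s) to
-- upd, and any other kind s the answer to the query (idx s, arg s).
module Loop (kindFn idxFn argFn : Fn 1) (updFn startFn : Fn 2) where

  kind idx arg : ℕ → ℕ
  kind s = ⟦ kindFn ⟧ (s ∷ [])
  idx s  = ⟦ idxFn ⟧ (s ∷ [])
  arg s  = ⟦ argFn ⟧ (s ∷ [])

  upd start : ℕ → ℕ → ℕ
  upd s a   = ⟦ updFn ⟧ (s ∷ a ∷ [])
  start v m = ⟦ startFn ⟧ (v ∷ m ∷ [])

  opaque
    starting preparing updating : Cmd
    starting = call startFn (1 ∷ 0 ∷ []) 2 ⨟ clear 0 ⨟ transfer 2 0 ⨟ clearAll 1 1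
    -- Leaves the argument in register 0, the kind in 1, the index in 3 and the state in 4. The
    -- answer will replace the argument, next to the saved state from which `updating` continues.
    preparing =
      call kindFn (0 ∷ []) 1 ⨟ call argFn (0 ∷ []) 2 ⨟ call idxFn (0 ∷ []) 3 ⨟
      transfer 0 4 ⨟ transfer 2 0
    updating = call updFn (4 ∷ 0 ∷ []) 5 ⨟ clear 0 ⨟ transfer 5 0 ⨟ clearAll 1 4

    starting-spec : ∀ {m v ρ} → Stored 0 (m ∷ v ∷ []) ρ →
                    ∃[ ρ′ ] Exec starting ρ ρ′ × Stored 0 (start v m ∷ []) ρ′
    starting-spec {m} {v} {ρ} st@(e₀ , e₁ , _)
      with ρ₁ , x , _ , f₁ , f₂ , st₁ ← call-spec startFn (m ∷ v ∷ []) st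
             ((s≤s (s≤s z≤n) , e₁) ∷ (s≤s z≤n , e₀) ∷ [])
      with ρ₂ , y , t ← clear-spec 0 ρ₁
      with ρ₃ , z , T ← transfer-spec {2} {0} ρ₂ (λ ())
      with ρ₄ , w , b , st₄ ← clearAll-spec 1 (v ∷ [])
             ( trans (T .others 1 (λ ()) (λ ())) (trans (t .there 1 (λ ())) f₁)
             , Stored-replace (T .source) (Stored-resp 3 [] (λ j l →
                 trans (T .others j (>⇒≢ l) (>⇒≢ (≤-trans (s≤s z≤n) l)))
                       (t .there j (>⇒≢ (≤-trans (s≤s z≤n) l)))) st₁)) =
      ρ₄ , exec-seq x (exec-seq y (exec-seq z w)) ,
      trans (b 0 ≤-refl) (trans (T .target)
        (trans (cong₂ _+_ (trans (t .there 2 (λ ())) f₂) (t .here)) (+-identityʳ _))) ,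
      st₄

    preparing-spec : ∀ {s ρ} → Stored 0 (s ∷ []) ρ →
                     ∃[ ρ′ ] Exec preparing ρ ρ′ ×
                             Stored 0 (arg s ∷ kind s ∷ 0 ∷ idx s ∷ s ∷ []) ρ′
    preparing-spec {s} {ρ} st
      with ρ₁ , x₁ , st₁ ← call-spec kindFn (s ∷ []) st ((s≤s z≤n , st .proj₁) ∷ [])
      with ρ₂ , x₂ , st₂ ← call-spec argFn (s ∷ kind s ∷ []) st₁ ((s≤s z≤n , st₁ .proj₁) ∷ [])
      with ρ₃ , x₃ , e₀ , e₁ , e₂ , e₃ , st₃ ←
             call-spec idxFn (s ∷ kind s ∷ arg s ∷ []) st₂ ((s≤s z≤n , st₂ .proj₁) ∷ [])
      with ρ₄ , x₄ , T ← transfer-spec {0} {4} ρ₃ (λ ())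
      with ρ₅ , x₅ , U ← transfer-spec {2} {0} ρ₄ (λ ()) =
      ρ₅ , exec-seq x₁ (exec-seq x₂ (exec-seq x₃ (exec-seq x₄ x₅))) ,
      trans (U .target) (trans (cong₂ _+_ (trans (T .others 2 (λ ()) (λ ())) e₂) (T .source))
                               (+-identityʳ _)) ,
      trans (U .others 1 (λ ()) (λ ())) (trans (T .others 1 (λ ()) (λ ())) e₁) ,
      U .source ,
      trans (U .others 3 (λ ()) (λ ())) (trans (T .others 3 (λ ()) (λ ())) e₃) ,
      trans (U .others 4 (λ ()) (λ ())) (trans (T .target)
        (trans (cong₂ _+_ e₀ (st₃ 4 ≤-refl)) (+-identityʳ _))) ,
      Stored-resp 5 [] (λ j l →
        trans (U .others j (>⇒≢ (≤-trans (s≤s (s≤s (s≤s z≤n))) l)) (>⇒≢ (≤-trans (s≤s z≤n) l)))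
              (T .others j (>⇒≢ (≤-trans (s≤s z≤n) l)) (>⇒≢ l)))
        (Stored-suc st₃)

    updating-spec : ∀ {a k i s ρ} → Stored 0 (a ∷ k ∷ 0 ∷ i ∷ s ∷ []) ρ →
                    ∃[ ρ′ ] Exec updating ρ ρ′ × Stored 0 (upd s a ∷ []) ρ′
    updating-spec {a} {k} {i} {s} st@(e₀ , e₁ , e₂ , e₃ , e₄ , _)
      with ρ₁ , x , _ , f₁ , f₂ , f₃ , f₄ , f₅ , st₁ ← call-spec updFn (a ∷ k ∷ 0 ∷ i ∷ s ∷ []) st
             ((≤-refl , e₄) ∷ (s≤s z≤n , e₀) ∷ [])
      with ρ₂ , y , t ← clear-spec 0 ρ₁
      with ρ₃ , z , T ← transfer-spec {5} {0} ρ₂ (λ ())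
      with ρ₄ , w , b , st₄ ← clearAll-spec 1 (k ∷ 0 ∷ i ∷ s ∷ [])
             ( trans (T .others 1 (λ ()) (λ ())) (trans (t .there 1 (λ ())) f₁)
             , trans (T .others 2 (λ ()) (λ ())) (trans (t .there 2 (λ ())) f₂)
             , trans (T .others 3 (λ ()) (λ ())) (trans (t .there 3 (λ ())) f₃)
             , trans (T .others 4 (λ ()) (λ ())) (trans (t .there 4 (λ ())) f₄)
             , Stored-replace (T .source) (Stored-resp 6 [] (λ j l →
                 trans (T .others j (>⇒≢ l) (>⇒≢ (≤-trans (s≤s z≤n) l)))
                       (t .there j (>⇒≢ (≤-trans (s≤s z≤n) l)))) st₁)) =
      ρ₄ , exec-seq x (exec-seq y (exec-seq z w)) ,
      trans (b 0 ≤-refl) (trans (T .target)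
        (trans (cong₂ _+_ (trans (t .there 5 (λ ())) f₅) (t .here)) (+-identityʳ _))) ,
      st₄

  -- The layout of the machine with the constant v: on entry it jumps to the
  -- last part, which writes v on tape 1.

  loopState branchState updateState constantState : ℕ
  loopState     = end starting 1
  branchState   = end preparing loopState
  updateState   = 4 + branchState
  constantState = suc (end updating updateState)

  -- The first state behind the table, hence a halting one. As the constant is written by the last
  -- part, this address is the only thing before that part that depends on v, which keeps the table
  -- easily primitive recursive in v.
  exitState : ℕ → ℕ
  exitState v = suc (end (incs v) constantState)

  front middle : Program
  front = jump constantState ∷ assemble starting 1 ⧺ assemble preparing loopState
  middle =
    -- The test at `branchState` has already decremented the kind, so this second test separates
    -- kind 1 from the larger ones.
    branch 1 (3 + branchState) (2 + branchState) ∷ query 3 0 updateState ∷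
    oracle 0 updateState ∷ assemble updating updateState ⧺ jump loopState ∷ []

  constant : ℕ → Program
  constant v = assemble (incs v) constantState ⧺ jump 1 ∷ []

  opaque
    machine : ℕ → Program
    machine v =
      front ⧺ branch 1 (exitState v) (1 + branchState) ∷ middle ⧺ constant v

  module Moves (X : ℕ → ℕ) (A : ℕ → ℕ → ℕ → Set) where

    data _⟶_ (s : ℕ) : ℕ → Set where
      oracle-move : kind s ≡ 1 → s ⟶ upd s (X (arg s))
      query-move  : ∀ {k a} → kind s ≡ suc (suc k) → A (idx s) (arg s) a → s ⟶ upd s a

    data Stops (s n : ℕ) : Set where
      stopped : ∀ {s′} → Star _⟶_ s s′ → kind s′ ≡ 0 → arg s′ ≡ n → Stops s n

    data GoesOn (s : ℕ) : Set where
      going-on : (f : ℕ → ℕ) → f 0 ≡ s → (∀ t → f t ⟶ f (suc t)) → GoesOn s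

  -- Machine runs and state transitions

  module Simulation (X : ℕ → ℕ) (v : ℕ) (p : Program) (p≡machine : p ≡ machine v) where

    open Machine X p

    private
      afterFront : Program
      afterFront = branch 1 (exitState v) (1 + branchState) ∷ middle ⧺ constant v

      opaque
        unfolding machine

        entry-at : fetch p 0 ≡ just (jump constantState)
        entry-at = cong (λ p → fetch p 0) p≡machine

        starting-at : drop 1 p ≡ assemble starting 1 ⧺ assemble preparing loopState ⧺ afterFront
        starting-at =
          trans (cong (drop 1) p≡machine) (++-assoc (assemble starting 1) _ _)

      preparing-at : drop loopState p ≡ assemble preparing loopState ⧺ afterFront
      preparing-at = drop-end starting starting-at

      branch-at : drop branchState p ≡ afterFront
      branch-at = drop-end preparing preparing-at

      middle-at : drop (1 + branchState) p ≡ middle ⧺ constant v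
      middle-at = drop-next branchState branch-at

      query-at : drop (2 + branchState) p ≡ _
      query-at = drop-next (1 + branchState) middle-at

      oracle-at : drop (3 + branchState) p ≡ _
      oracle-at = drop-next (2 + branchState) query-at

      updating-at : drop updateState p ≡
                    assemble updating updateState ⧺ jump loopState ∷ constant v
      updating-at =
        trans (drop-next (3 + branchState) oracle-at) (++-assoc (assemble updating updateState) _ _)

      loop-at : drop (end updating updateState) p ≡ jump loopState ∷ constant v
      loop-at = drop-end updating updating-at

      constant-at : drop constantState p ≡ constant v
      constant-at = drop-next (end updating updateState) loop-at

      start-at : drop (end (incs v) constantState) p ≡ jump 1 ∷ []
      start-at = drop-end (incs v) constant-at

      exit-at : drop (exitState v) p ≡ []
      exit-at = drop-next (end (incs v) constantState) start-at

    Ready : ℕ → Config → Set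
    Ready s c = Config.state c ≡ loopState × Stored 0 (s ∷ []) (registers (Config.tapes c))

    Stored-registers : ∀ {m} s (vs : Vec ℕ m) (T : Tapes) {ρ} →
                       (∀ j → number (T j) ≡ ρ j) → Stored s vs ρ → Stored s vs (registers T)
    Stored-registers s vs T eq = Stored-resp s vs λ j _ → eq j

    initial-stored : ∀ m → Stored 0 (m ∷ 0 ∷ []) (registers (Config.tapes (initial m)))
    initial-stored m =
      number-numeral m , refl , λ { (suc j) _ → refl }

    opaque
      start-up : ∀ m → ∃[ c ] Silent (initial m) c × Ready (start v m) c
      start-up m
        with T₁ , x₁ , eq₁ ← jump-step {q = 0} {initial m .Config.tapes} entry-at
        with _ , y₂ , st₂ ← incs-spec v (Stored-registers 0 (m ∷ 0 ∷ []) T₁ eq₁ (initial-stored m))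
        with T₂ , x₂ , eq₂ ← simulate y₂ (λ _ → refl) constant-at
        with T₃ , x₃ , eq₃ ← jump-step (drop-fetch (end (incs v) constantState) start-at)
        with _ , y₄ , st₄ ← starting-spec (Stored-registers 0 (m ∷ v + 0 ∷ []) T₃
                              (λ j → trans (eq₃ j) (eq₂ j)) st₂)
        with T₄ , x₄ , eq₄ ← simulate y₄ (λ _ → refl) starting-at =
        _ , x₁ ◅ x₂ ◅◅ x₃ ◅ x₄ , refl ,
        subst (λ k → Stored 0 (start k m ∷ []) (registers T₄)) (+-identityʳ v)
          (Stored-registers 0 (_ ∷ []) T₄ eq₄ st₄)

    module _ (A : ℕ → ℕ → ℕ → Set) where

      open Moves X A

      _↝_ : Config → Config → Set
      _↝_ = Step X A p

      Leads : Config → ℕ → Set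
      Leads c s = ∃[ c′ ] Silent c c′ × Ready s c′

      -- One round of the loop, run silently until it halts or arrives at its oracle or query
      -- instruction. The two functions of `continues` are the two halves of a bisimulation between
      -- the step taken there and the moves of the state.
      data Cycle (s : ℕ) (c : Config) : Set where
        stops : ∀ {c₁} → kind s ≡ 0 → Silent c c₁ → fetch p (Config.state c₁) ≡ nothing →
                output c₁ ≡ arg s → Cycle s c
        continues : ∀ {c₁ i} → kind s ≢ 0 → Silent c c₁ → fetch p (Config.state c₁) ≡ just i →
                    (∀ {s′} → s ⟶ s′ → ∃[ c₂ ] c₁ ↝ c₂ × Leads c₂ s′) →
                    (∀ {c₂} → c₁ ↝ c₂ → ∃[ s′ ] s ⟶ s′ × Leads c₂ s′) → Cycle s c

      oracle-inversion : ∀ {q T i r c} → fetch p q ≡ just (oracle i r) → config q T ↝ c →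
                         c ≡ config r (T [ i ≔ numeral (X (number (T i))) ])
      oracle-inversion f (act-step g)     with () ← trans (sym f) g
      oracle-inversion f (oracle-step g)  with refl ← trans (sym f) g = refl
      oracle-inversion f (query-step g _) with () ← trans (sym f) g

      query-inversion : ∀ {q T i j r c} → fetch p q ≡ just (query i j r) → config q T ↝ c →
                        ∃[ a ] A (number (T i)) (number (T j)) a × c ≡ config r (T [ j ≔ numeral a ])
      query-inversion f (act-step g)     with () ← trans (sym f) g
      query-inversion f (oracle-step g)  with () ← trans (sym f) g
      query-inversion f (query-step g a) with refl ← trans (sym f) g = _ , a , refl

      update-leads : ∀ {a b k i s T} → Stored 0 (b ∷ k ∷ 0 ∷ i ∷ s ∷ []) (registers T) →
                     Leads (config updateState (T [ 0 ≔ numeral a ])) (upd s a)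
      update-leads {a} {k = k} {i} {s} {T} (_ , e₁ , e₂ , e₃ , e₄ , st)
        with t ← ≔-sets T 0 (numeral a)
        with _ , y₁ , st₁ ← updating-spec {a} {k} {i} {s} {registers (T [ 0 ≔ numeral a ])}
               ( trans (t .here) (number-numeral a) , trans (t .there 1 (λ ())) e₁
               , trans (t .there 2 (λ ())) e₂ , trans (t .there 3 (λ ())) e₃
               , trans (t .there 4 (λ ())) e₄ , Stored-sets 5 [] (s≤s z≤n) t st)
        with T₁ , x₁ , eq₁ ← simulate y₁ (λ _ → refl) updating-at
        with T₂ , x₂ , eq₂ ← jump-step (drop-fetch (end updating updateState) loop-at) =
        _ , x₁ ◅◅ x₂ ◅ ε , refl ,
        Stored-registers 0 (_ ∷ []) T₂ (λ j → trans (eq₂ j) (eq₁ j)) st₁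

      dispatch : ∀ {s c T₁} k → kind s ≡ k → Silent c (config branchState T₁) →
                 Stored 0 (arg s ∷ k ∷ 0 ∷ idx s ∷ s ∷ []) (registers T₁) → Cycle s c
      dispatch {s} 0 ks x₁ (e₀ , e₁ , _)
        with T₂ , x₂ , eq₂ ← branch-zero (drop-fetch branchState branch-at) e₁ =
        stops ks (x₁ ◅◅ x₂ ◅ ε) (cong head exit-at) (trans (eq₂ 0) e₀)
      dispatch {s} 1 ks x₁ (e₀ , e₁ , e₂ , e₃ , e₄ , st₁)
        with T₂ , x₂ , t₂ ← branch-suc (drop-fetch branchState branch-at) e₁
        with T₃ , x₃ , eq₃ ← branch-zero (drop-fetch (1 + branchState) middle-at) (t₂ .here) =
        continues (λ e → case trans (sym ks) e of λ ()) (x₁ ◅◅ x₂ ◅ x₃ ◅ ε)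
          (drop-fetch (3 + branchState) oracle-at)
          (λ { (oracle-move _) → _ , oracle-step (drop-fetch (3 + branchState) oracle-at) , leads
             ; (query-move ks′ _) → case trans (sym ks) ks′ of λ () })
          (λ { c → _ , oracle-move ks ,
                   subst (λ c → Leads c (upd s (X (arg s))))
                     (sym (oracle-inversion (drop-fetch (3 + branchState) oracle-at) c)) leads })
        where
        e₀′ : number (T₃ 0) ≡ arg s
        e₀′ = trans (eq₃ 0) (trans (t₂ .there 0 (λ ())) e₀)
        leads : Leads (config updateState (T₃ [ 0 ≔ numeral (X (number (T₃ 0))) ])) (upd s (X (arg s)))
        leads rewrite e₀′ = update-leads (e₀′ , trans (eq₃ 1) (t₂ .here) ,
          trans (eq₃ 2) (trans (t₂ .there 2 (λ ())) e₂) ,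
          trans (eq₃ 3) (trans (t₂ .there 3 (λ ())) e₃) ,
          trans (eq₃ 4) (trans (t₂ .there 4 (λ ())) e₄) ,
          Stored-registers 5 [] T₃ eq₃ (Stored-sets 5 [] (s≤s (s≤s z≤n)) t₂ st₁))
      dispatch {s} (suc (suc k)) ks x₁ (e₀ , e₁ , e₂ , e₃ , e₄ , st₁)
        with T₂ , x₂ , t₂ ← branch-suc (drop-fetch branchState branch-at) e₁
        with T₃ , x₃ , t₃ ← branch-suc (drop-fetch (1 + branchState) middle-at) (t₂ .here) =
        continues (λ e → case trans (sym ks) e of λ ()) (x₁ ◅◅ x₂ ◅ x₃ ◅ ε)
          (drop-fetch (2 + branchState) query-at)
          (λ { (oracle-move ks′) → case trans (sym ks) ks′ of λ ()
             ; (query-move _ a) →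
                 _ , query-step (drop-fetch (2 + branchState) query-at)
                       (subst₂ (λ i j → A i j _) (sym e₃′) (sym e₀′) a) ,
                 leads })
          (λ c → let a , Aa , eq = query-inversion (drop-fetch (2 + branchState) query-at) c in
                 _ , query-move ks (subst₂ (λ i j → A i j a) e₃′ e₀′ Aa) ,
                 subst (λ c → Leads c (upd s a)) (sym eq) leads)
        where
        e₀′ : number (T₃ 0) ≡ arg s
        e₀′ = trans (t₃ .there 0 (λ ())) (trans (t₂ .there 0 (λ ())) e₀)
        e₃′ : number (T₃ 3) ≡ idx s
        e₃′ = trans (t₃ .there 3 (λ ())) (trans (t₂ .there 3 (λ ())) e₃)
        leads : ∀ {a} → Leads (config updateState (T₃ [ 0 ≔ numeral a ])) (upd s a)
        leads = update-leads (e₀′ , t₃ .here ,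
          trans (t₃ .there 2 (λ ())) (trans (t₂ .there 2 (λ ())) e₂) , e₃′ ,
          trans (t₃ .there 4 (λ ())) (trans (t₂ .there 4 (λ ())) e₄) ,
          Stored-sets 5 [] (s≤s (s≤s z≤n)) t₃ (Stored-sets 5 [] (s≤s (s≤s z≤n)) t₂ st₁))

      cycle : ∀ {s c} → Ready s c → Cycle s c
      cycle {s} {config _ T} (refl , st)
        with _ , y₁ , st₁ ← preparing-spec st
        with T₁ , x₁ , eq₁ ← simulate y₁ (λ _ → refl) preparing-at =
        dispatch (kind s) refl x₁
          (Stored-registers 0 (arg s ∷ kind s ∷ 0 ∷ idx s ∷ s ∷ []) T₁ eq₁ st₁)

      deterministic : ∀ {c c₁ c₂} → Step X (λ _ _ _ → ⊥) p c c₁ → c ↝ c₂ → c₁ ≡ c₂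
      deterministic (act-step f)    (act-step g)     with refl ← trans (sym f) g = refl
      deterministic (act-step f)    (oracle-step g)  with () ← trans (sym f) g
      deterministic (act-step f)    (query-step g _) with () ← trans (sym f) g
      deterministic (oracle-step f) r                = sym (oracle-inversion f r)

      voice-step : ∀ {c c₁} → Step X (λ _ _ _ → ⊥) p c c₁ → c ↝ c₁
      voice-step (act-step f)    = act-step f
      voice-step (oracle-step f) = oracle-step f

      voice : ∀ {c c₁} → Silent c c₁ → Star _↝_ c c₁
      voice = gmap (λ c → c) voice-step

      Halting : Config → ℕ → Set
      Halting c n = fetch p (Config.state c) ≡ nothing × output c ≡ n

      stops⇒halts : ∀ {s s′ n c} → Star _⟶_ s s′ → kind s′ ≡ 0 → arg s′ ≡ n → Ready s c →
                    ∃[ c′ ] Star _↝_ c c′ × Halting c′ n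
      stops⇒halts ε k a r with cycle r
      ... | stops _ x h o       = _ , voice x , h , trans o a
      ... | continues k≢0 _ _ _ _ = ⊥-elim (k≢0 k)
      stops⇒halts (m ◅ ms) k a r with cycle r
      stops⇒halts (oracle-move k₀ ◅ _) _ _ _  | stops k₁ _ _ _ with () ← trans (sym k₀) k₁
      stops⇒halts (query-move k₀ _ ◅ _) _ _ _ | stops k₁ _ _ _ with () ← trans (sym k₀) k₁
      stops⇒halts (m ◅ ms) k a r | continues _ x _ fwd _
        with _ , y , _ , z , r′ ← fwd m
        with _ , w , h ← stops⇒halts ms k a r′ = _ , voice x ◅◅ y ◅ voice z ◅◅ w , h

      -- The bound on the length serves for induction: a cycle uses at least one step.
      data Run (n : ℕ) : ℕ → Config → Set where
        halted : ∀ {steps c} → Halting c n → Run n steps c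
        step   : ∀ {steps c c₁} → c ↝ c₁ → Run n steps c₁ → Run n (suc steps) c

      run : ∀ {n c c′} → Star _↝_ c c′ → Halting c′ n → ∃[ steps ] Run n steps c
      run ε        h = 0 , halted h
      run (x ◅ xs) h = _ , step x (run xs h .proj₂)

      run-more : ∀ {n steps c} → Run n steps c → Run n (suc steps) c
      run-more (halted h)  = halted h
      run-more (step x xs) = step x (run-more xs)

      -- Silent steps are forced, so a halting run has to begin with them. The bound need not shrink
      -- here: the decrease comes from the oracle or query step of each cycle.
      run-after : ∀ {n steps c c₁} → Silent c c₁ → Run n steps c → Run n steps c₁
      run-after ε        xs = xs
      run-after (y ◅ ys) (halted h) = ⊥-elim (step-fetch (voice-step y) (h .proj₁))
      run-after (y ◅ ys) (step x xs) with refl ← deterministic y x = run-more (run-after ys xs)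

      run⇒stops : ∀ {n s c} steps → Ready s c → Run n steps c → Stops s n
      run⇒stops steps r xs with cycle r
      ... | stops k x h o with run-after x xs
      ...   | halted (_ , o′) = stopped ε k (trans (sym o) o′)
      ...   | step y _        = ⊥-elim (step-fetch y h)
      run⇒stops steps r xs | continues _ x f _ bwd with run-after x xs
      ...   | halted (h , _) with () ← trans (sym f) h
      run⇒stops (suc steps) r xs | continues _ x f _ bwd | step y ys
        with _ , m , _ , z , r′ ← bwd y
        with stopped ms k a ← run⇒stops steps r′ (run-after z ys) = stopped (m ◅ ms) k a

      -- The configurations of an infinite run, each with the rest of its cycle.
      data Going (f : ℕ → ℕ) (c : Config) : Set where
        going : ∀ t {c₁ c₂} → c ↝ c₁ → Star _↝_ c₁ c₂ → Ready (f t) c₂ → Going f c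

      module _ {f : ℕ → ℕ} (moves : ∀ t → f t ⟶ f (suc t)) where

        ready-going : ∀ t {c} → Ready (f t) c → Going f c
        ready-going t r with cycle r
        ... | stops k _ _ _ = ⊥-elim (moving (moves t) k)
          where
          moving : ∀ {s s′} → s ⟶ s′ → kind s ≢ 0
          moving (oracle-move k₀)  k₁ with () ← trans (sym k₀) k₁
          moving (query-move k₀ _) k₁ with () ← trans (sym k₀) k₁
        -- `going` must start with an actual step; when the silent stretch is empty, the step
        -- realizing the move serves.
        ... | continues _ ε _ fwd _
          with _ , y , _ , z , r′ ← fwd (moves t) = going (suc t) y (voice z) r′
        ... | continues _ (x ◅ xs) _ fwd _
          with _ , y , _ , z , r′ ← fwd (moves t) =
          going (suc t) (voice-step x) (voice xs ◅◅ y ◅ voice z) r′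

        go-on : ∀ {c} → Going f c → ∃[ c₁ ] c ↝ c₁ × Going f c₁
        go-on (going t x ε r)        = _ , x , ready-going t r
        go-on (going t x (y ◅ ys) r) = _ , x , going t y ys r

        trace : ∀ {c} → Going f c → ℕ → ∃[ c ] Going f c
        trace g zero    = _ , g
        trace g (suc t) = let c , _ , g′ = go-on (trace g t .proj₂) in c , g′

        lead-going : ∀ t {c c′} → Silent c c′ → Ready (f t) c′ → Going f c
        lead-going t ε        r = ready-going t r
        lead-going t (x ◅ xs) r = going t (voice-step x) (voice xs) r

      module _ {r : ℕ → Config} (run : ∀ t → r t ↝ r (suc t)) where

        reaches : ∀ {c} t → Silent (r t) c → ∃[ u ] r u ≡ c
        reaches t xs = go t refl xs
          where
          go : ∀ {c₀ c} t → r t ≡ c₀ → Silent c₀ c → ∃[ u ] r u ≡ c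
          go t eq   ε        = t , eq
          go t refl (x ◅ xs) = go (suc t) (sym (deterministic x (run t))) xs

        -- A moment at which an infinite run stands at the head of the loop. Determinism of the
        -- silent stretches, in the form of `reaches`, yields a next such moment, and reading off
        -- the states gives an infinite sequence of moves.
        record Visit : Set where
          constructor visit
          field
            time value : ℕ
            ready      : Ready value (r time)

        open Visit

        revisit : (w : Visit) → ∃[ w′ ] value w ⟶ value w′
        revisit (visit t s rd) with cycle rd
        ... | stops _ x h _ with u , refl ← reaches t x = ⊥-elim (step-fetch (run u) h)
        ... | continues _ x _ _ bwd
          with u , refl ← reaches t x
          with s′ , m , _ , z , rd′ ← bwd (run u)
          with u′ , refl ← reaches (suc u) z = visit u′ s′ rd′ , m

        visits : Visit → ℕ → Visit
        visits w zero    = w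
        visits w (suc t) = revisit (visits w t) .proj₁

        runs⇒goes-on : (w : Visit) → GoesOn (value w)
        runs⇒goes-on w =
          going-on (λ t → value (visits w t)) refl λ t → revisit (visits w t) .proj₂

  module _ (X : ℕ → ℕ) (A : ℕ → ℕ → ℕ → Set) {v e : ℕ} (e≡machine : program e ≡ machine v) where

    open Machine X (program e)
    open Simulation X v (program e) e≡machine
    open Moves X A

    stops-halts : ∀ {m n} → Stops (start v m) n → Halts X A e m n
    stops-halts {m} (stopped ms k a)
      with c , x , r ← start-up m
      with c′ , y , h , o ← stops⇒halts A ms k a r = halts (voice A x ◅◅ y) h o

    halts-stops : ∀ {m n} → Halts X A e m n → Stops (start v m) n
    halts-stops {m} (halts xs h o)
      with c , x , r ← start-up m
      with steps , ys ← run A xs (h , o) = run⇒stops A steps r (run-after A x ys)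

    goes-on-runs : ∀ {m} → GoesOn (start v m) → RunsForever X A e m
    goes-on-runs {m} (going-on f eq moves)
      with c , x , r ← start-up m
      with g ← lead-going A moves 0 x (subst (λ s → Ready s c) (sym eq) r) =
      runs-forever (λ t → trace A moves g t .proj₁) refl
        λ t → go-on A moves (trace A moves g t .proj₂) .proj₂ .proj₁

    runs-goes-on : ∀ {m} → RunsForever X A e m → GoesOn (start v m)
    runs-goes-on {m} (runs-forever r r₀ steps)
      with c , x , rd ← start-up m
      with u , refl ← reaches A steps 0 (subst (λ c₀ → Silent c₀ c) (sym r₀) x) =
      runs⇒goes-on A steps (visit u _ rd)

-- Notation for composition, and facts on coded pairs

infix 30 _⟨_⟩ _⟨_∣_⟩ _⟨_∣_∣_⟩
_⟨_⟩ : ∀ {n} → Fn 1 → Fn n → Fn n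
f ⟨ x ⟩ = f · (x ∷ [])

_⟨_∣_⟩ : ∀ {n} → Fn 2 → Fn n → Fn n → Fn n
f ⟨ x ∣ y ⟩ = f · (x ∷ y ∷ [])

_⟨_∣_∣_⟩ : ∀ {n} → Fn 3 → Fn n → Fn n → Fn n → Fn n
f ⟨ x ∣ y ∣ z ⟩ = f · (x ∷ y ∷ z ∷ [])

π₁-pair : ∀ x y → π₁ (pair x y) ≡ x
π₁-pair x y = cong proj₁ (unpair-pair x y)

π₂-pair : ∀ x y → π₂ (pair x y) ≡ y
π₂-pair x y = cong proj₂ (unpair-pair x y)

π₂-≤ : ∀ n → π₂ n ≤ n
π₂-≤ n = ≤-trans (m≤n+m (π₂ n) (triangle (π₁ n + π₂ n))) (≤-reflexive (pair-unpair n))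

iterate-fixed : ∀ f k {x} → f x ≡ x → iterate f k x ≡ x
iterate-fixed f zero    eq = refl
iterate-fixed f (suc k) eq = trans (cong f (iterate-fixed f k eq)) eq

-- Coded sequences

tailFn : Fn 1
tailFn = second ⟨ predecessor ⟨ var 0F ⟩ ⟩

suffixFn : Fn 2
suffixFn = iteration (tailFn ⟨ var 0F ⟩) ⟨ var 1F ∣ var 0F ∣ nat 0 ⟩

-- The empty sequence is its own tail, since `π₂ (pred 0)` is 0; beyond the end, `suffix` therefore
-- stays at 0, in agreement with `drop`.
tail : ℕ → ℕ
tail c = π₂ (pred c)

suffix : ℕ → ℕ → ℕ
suffix c q = iterate tail q c

-- The rest of a sequence has a smaller code, so any fuel not below the code suffices. This frees
-- the recursion equation of `decodeSeq` from fuel.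
decodeSeqWith-fuel : ∀ f g c → c ≤ f → c ≤ g → decodeSeqWith f c ≡ decodeSeqWith g c
decodeSeqWith-fuel f       g       zero    _       _       = refl
decodeSeqWith-fuel (suc f) (suc g) (suc n) (s≤s p) (s≤s q) =
  cong (π₁ n ∷_) (decodeSeqWith-fuel f g (π₂ n) (≤-trans (π₂-≤ n) p) (≤-trans (π₂-≤ n) q))

decodeSeq-suc : ∀ n → decodeSeq (suc n) ≡ π₁ n ∷ decodeSeq (π₂ n)
decodeSeq-suc n = cong (π₁ n ∷_) (decodeSeqWith-fuel n (π₂ n) (π₂ n) (π₂-≤ n) ≤-refl)

drop-decodeSeq : ∀ e q → drop q (decodeSeq e) ≡ decodeSeq (suffix e q)
drop-decodeSeq e zero    = refl
drop-decodeSeq e (suc q) =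
  trans (cong (λ k → drop k (decodeSeq e)) (+-comm 1 q))
  (trans (sym (drop-drop q 1 (decodeSeq e)))
  (trans (cong (drop 1) (drop-decodeSeq e q)) (drop-one (suffix e q))))
  where
  drop-one : ∀ c → drop 1 (decodeSeq c) ≡ decodeSeq (tail c)
  drop-one zero    = refl
  drop-one (suc n) = cong (drop 1) (decodeSeq-suc n)

fetch-program : ∀ e q → fetch (program e) q ≡ head (map decodeInstruction (decodeSeq (suffix e q)))
fetch-program e q =
  cong head (trans (drop-map q (decodeSeq e)) (cong (map decodeInstruction) (drop-decodeSeq e q)))

fetch-none : ∀ e q → suffix e q ≡ 0 → fetch (program e) q ≡ nothing
fetch-none e q eq =
  trans (fetch-program e q) (cong (λ c → head (map decodeInstruction (decodeSeq c))) eq)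

fetch-some : ∀ e q {n} → suffix e q ≡ suc n → fetch (program e) q ≡ just (decodeInstruction (π₁ n))
fetch-some e q {n} eq =
  trans (fetch-program e q) (trans (cong (λ c → head (map decodeInstruction (decodeSeq c))) eq)
    (cong (λ cs → head (map decodeInstruction cs)) (decodeSeq-suc n)))

-- Coded tapes

-- Blanks at the far end do not affect the number, so explicit and implicit blanks have the same
-- code, and a blank tape has code 0.
bits : List Bool → ℕ
bits []          = 0
bits (false ∷ l) = dbl (bits l)
bits (true ∷ l)  = suc (dbl (bits l))

tapeCode : Tape → ℕ
tapeCode (tape l r) = pair (bits l) (bits r)

parity-bits : ∀ s l → parity (bits (s ∷ l)) ≡ encodeSymbol s
parity-bits false l = parity-dbl (bits l)
parity-bits true  l = parity-suc-dbl (bits l)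

half-bits : ∀ s l → half (bits (s ∷ l)) ≡ bits l
half-bits false l = half-dbl (bits l)
half-bits true  l = half-suc-dbl (bits l)

bits-∷ : ∀ s l → encodeSymbol s + dbl (bits l) ≡ bits (s ∷ l)
bits-∷ false l = refl
bits-∷ true  l = refl

-- The number 2^a - 1, whose binary word consists of a ones.
fullFn : Fn 1
fullFn = iteration (succ ⟨ double ⟨ var 0F ⟩ ⟩) ⟨ var 0F ∣ nat 0 ∣ nat 0 ⟩

numeralFn : Fn 1
numeralFn = pairing ⟨ nat 0 ∣ fullFn ⟩

numeralCode : ℕ → ℕ
numeralCode a = ⟦ numeralFn ⟧ (a ∷ [])

numeralCode-correct : ∀ a → numeralCode a ≡ tapeCode (numeral a)
numeralCode-correct a = cong (pair 0) (go a)
  where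
  go : ∀ a → ⟦ fullFn ⟧ (a ∷ []) ≡ bits (replicate a true)
  go zero    = refl
  go (suc a) = cong (λ n → suc (dbl n)) (go a)

-- Acts on pairs of a count and a remaining word. A word starting with a blank is even and makes the
-- pair a fixed point, so surplus iterations are harmless.
eatFn : Fn 1
eatFn = ifZero ⟨ parityFn ⟨ second ⟨ var 0F ⟩ ⟩ ∣ var 0F
               ∣ pairing ⟨ succ ⟨ first ⟨ var 0F ⟩ ⟩ ∣ halfFn ⟨ second ⟨ var 0F ⟩ ⟩ ⟩ ⟩

-- A word is its own bound for the number of its leading ones.
onesFn : Fn 1
onesFn = first ⟨ iteration (eatFn ⟨ var 0F ⟩) ⟨ var 0F ∣ pairing ⟨ nat 0 ∣ var 0F ⟩ ∣ nat 0 ⟩ ⟩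

ones-correct : ∀ r → ⟦ onesFn ⟧ (bits r ∷ []) ≡ strokes r
ones-correct r = go (bits r) 0 r (strokes≤bits r)
  where
  strokes≤bits : ∀ r → strokes r ≤ bits r
  strokes≤bits []          = z≤n
  strokes≤bits (false ∷ r) = z≤n
  strokes≤bits (true ∷ r)  = s≤s (≤-trans (strokes≤bits r) (m≤m+n _ _))
  eat : ℕ → ℕ
  eat x = ⟦ eatFn ⟧ (x ∷ [])
  eat-even : ∀ k n → parity n ≡ 0 → eat (pair k n) ≡ pair k n
  eat-even k n eq rewrite unpair-pair k n | eq = refl
  eat-odd : ∀ k n → parity n ≡ 1 → eat (pair k n) ≡ pair (suc k) (half n)
  eat-odd k n eq rewrite unpair-pair k n | eq = refl
  go : ∀ f k r → strokes r ≤ f → π₁ (iterate eat f (pair k (bits r))) ≡ k + strokes r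
  go f k [] _ =
    trans (cong π₁ (iterate-fixed eat f (eat-even k 0 refl)))
          (trans (π₁-pair k 0) (sym (+-identityʳ k)))
  go f k (false ∷ r) _ =
    trans (cong π₁ (iterate-fixed eat f (eat-even k _ (parity-bits false r))))
          (trans (π₁-pair k _) (sym (+-identityʳ k)))
  go (suc f) k (true ∷ r) (s≤s le) =
    trans (cong π₁ (sym (iterate-comm eat f _)))
    (trans (cong (λ x → π₁ (iterate eat f x))
             (trans (eat-odd k _ (parity-bits true r)) (cong (pair (suc k)) (half-bits true r))))
    (trans (go f (suc k) r le) (sym (+-suc k _))))

-- The arguments are the codes of an action and a tape.
performFn : Fn 2
performFn =
  ifZero ⟨ direction ∣ pairing ⟨ halfFn ⟨ l ⟩ ∣ cons (parityFn ⟨ l ⟩) r ⟩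
         ∣ ifZero ⟨ predecessor ⟨ direction ⟩ ∣ pairing ⟨ cons s l ∣ halfFn ⟨ r ⟩ ⟩ ∣ pairing ⟨ l ∣ r ⟩ ⟩ ⟩
  where
  cons : Fn 2 → Fn 2 → Fn 2
  cons s l = add ⟨ s ∣ double ⟨ l ⟩ ⟩
  s direction l r : Fn 2
  s         = ifZero ⟨ first ⟨ var 0F ⟩ ∣ nat 0 ∣ nat 1 ⟩
  direction = first ⟨ second ⟨ var 0F ⟩ ⟩
  l         = first ⟨ var 1F ⟩
  r         = cons s (halfFn ⟨ second ⟨ var 1F ⟩ ⟩)

performed : ℕ → ℕ → ℕ
performed a c = ⟦ performFn ⟧ (a ∷ c ∷ [])

half-bits-drop : ∀ r → half (bits r) ≡ bits (drop 1 r)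
half-bits-drop []      = refl
half-bits-drop (s ∷ r) = half-bits s r

write-drop : ∀ s l r → write s (tape l r) ≡ tape l (s ∷ drop 1 r)
write-drop s l []      = refl
write-drop s l (_ ∷ r) = refl

symbol-code : ∀ n → ifz n 0 1 ≡ encodeSymbol (decodeSymbol n)
symbol-code zero    = refl
symbol-code (suc n) = refl

moved : ∀ d s l r →
  ifz d (pair (half (bits l)) (parity (bits l) + dbl (bits (s ∷ r))))
    (ifz (pred d) (pair (encodeSymbol s + dbl (bits l)) (half (bits (s ∷ r))))
                  (pair (bits l) (bits (s ∷ r)))) ≡
  tapeCode (move (decodeDirection d) (tape l (s ∷ r)))
-- Beyond the end of the left list, the code 0 has parity and half 0 and so supplies a blank.
moved 0             s []      r = refl
moved 0             s (x ∷ l) r =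
  cong₂ pair (half-bits x l) (trans (cong (_+ dbl (bits (s ∷ r))) (parity-bits x l)) (bits-∷ x (s ∷ r)))
moved 1             s l       r = cong₂ pair (bits-∷ s l) (half-bits s r)
moved (suc (suc d)) s l       r = refl

performed-correct : ∀ a t → let action s d g = decodeAction a in
                    performed a (tapeCode t) ≡ tapeCode (move d (write s t))
performed-correct a (tape l r)
  rewrite unpair-pair (bits l) (bits r) | half-bits-drop r | symbol-code (π₁ a)
        | bits-∷ (decodeSymbol (π₁ a)) (drop 1 r) | write-drop (decodeSymbol (π₁ a)) l r =
  moved (π₁ (π₂ a)) (decodeSymbol (π₁ a)) l (drop 1 r)

-- Coded tape assignments are lists of updates, the latest one first; a tape
-- without update is blank, with code 0.

differenceFn : Fn 2
differenceFn = add ⟨ monus ⟨ var 0F ∣ var 1F ⟩ ∣ monus ⟨ var 1F ∣ var 0F ⟩ ⟩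

entryFn : Fn 1
entryFn = first ⟨ predecessor ⟨ var 0F ⟩ ⟩

-- An entry for the tape sought is a fixed point, and so is the empty list; iterating as often as
-- the code of the list says hence finds the latest entry.
skipFn : Fn 2
skipFn = ifZero ⟨ differenceFn ⟨ var 1F ∣ first ⟨ entryFn ⟨ var 0F ⟩ ⟩ ⟩ ∣ var 0F ∣ tailFn ⟨ var 0F ⟩ ⟩

cellFn : Fn 2
cellFn = second ⟨ entryFn ⟨ iteration skipFn ⟨ var 0F ∣ var 0F ∣ var 1F ⟩ ⟩ ⟩

putFn : Fn 3
putFn = succ ⟨ pairing ⟨ pairing ⟨ var 0F ∣ var 1F ⟩ ∣ var 2F ⟩ ⟩

numberFn : Fn 2
numberFn = onesFn ⟨ second ⟨ cellFn ⟩ ⟩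

skipTo : ℕ → ℕ → ℕ
skipTo i t = ⟦ skipFn ⟧ (t ∷ i ∷ [])

cell : ℕ → ℕ → ℕ
cell t i = ⟦ cellFn ⟧ (t ∷ i ∷ [])

put : ℕ → ℕ → ℕ → ℕ
put i c t = ⟦ putFn ⟧ (i ∷ c ∷ t ∷ [])

numberAt : ℕ → ℕ → ℕ
numberAt t i = ⟦ numberFn ⟧ (t ∷ i ∷ [])

ifz-zero : ∀ {c} a b → c ≡ 0 → ifz c a b ≡ a
ifz-zero a b refl = refl

ifz-suc : ∀ {c} a b → c ≢ 0 → ifz c a b ≡ b
ifz-suc {zero}  a b c≢0 = ⊥-elim (c≢0 refl)
ifz-suc {suc c} a b c≢0 = refl

skipTo-here : ∀ i c t → skipTo i (put i c t) ≡ put i c t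
skipTo-here i c t
  rewrite unpair-pair (pair i c) t | unpair-pair i c | n∸n≡0 i = refl

skipTo-there : ∀ {i j} c t → j ≢ i → skipTo j (put i c t) ≡ t
skipTo-there {i} {j} c t j≢i
  rewrite unpair-pair (pair i c) t | unpair-pair i c =
  ifz-suc _ _ λ eq → j≢i (≤-antisym (m∸n≡0⇒m≤n (m+n≡0⇒m≡0 (j ∸ i) eq))
                                    (m∸n≡0⇒m≤n (m+n≡0⇒n≡0 (j ∸ i) eq)))

-- Each proper skip lowers the code, so the search is over after at most `t` rounds. It is needed
-- because a longer list brings a larger number of iterations for the same remaining list.
skipTo-stable : ∀ i f g t → t ≤ f → t ≤ g → iterate (skipTo i) f t ≡ iterate (skipTo i) g t
skipTo-stable i f g zero _ _ =
  trans (iterate-fixed (skipTo i) f fixed) (sym (iterate-fixed (skipTo i) g fixed))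
  where
  fixed : skipTo i 0 ≡ 0
  fixed with (i ∸ 0) + (0 ∸ i)
  ... | zero  = refl
  ... | suc _ = refl
skipTo-stable i (suc f) (suc g) t@(suc k) (s≤s p) (s≤s q)
  with (i ∸ π₁ (π₁ k)) + (π₁ (π₁ k) ∸ i) in eq
... | zero  =
  trans (iterate-fixed (skipTo i) (suc f) fixed) (sym (iterate-fixed (skipTo i) (suc g) fixed))
  where
  fixed : skipTo i t ≡ t
  fixed = ifz-zero _ _ eq
... | suc n =
  trans (forward f)
        (trans (skipTo-stable i f g (π₂ k) (≤-trans (π₂-≤ k) p) (≤-trans (π₂-≤ k) q))
               (sym (forward g)))
  where
  forward : ∀ f → iterate (skipTo i) (suc f) t ≡ iterate (skipTo i) f (π₂ k)
  forward f = trans (sym (iterate-comm (skipTo i) f t))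
    (cong (iterate (skipTo i) f) (ifz-suc _ _ λ z → case trans (sym eq) z of λ ()))

cell-here : ∀ i c t → cell (put i c t) i ≡ c
cell-here i c t
  rewrite iterate-fixed (skipTo i) (put i c t) (skipTo-here i c t)
        | unpair-pair (pair i c) t | unpair-pair i c = refl

cell-there : ∀ {i j} c t → j ≢ i → cell (put i c t) j ≡ cell t j
cell-there {i} {j} c t j≢i = cong (λ u → π₂ (π₁ (pred u)))
  (trans (sym (iterate-comm (skipTo j) (pair (pair i c) t) (put i c t)))
  (trans (cong (iterate (skipTo j) (pair (pair i c) t)) (skipTo-there c t j≢i))
         (skipTo-stable j (pair (pair i c) t) t t (m≤n+m t (triangle (pair i c + t))) ≤-refl)))

record Represents (t : ℕ) (T : Tapes) : Set where
  constructor represents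
  field
    cell-represents : ∀ i → cell t i ≡ tapeCode (T i)

open Represents

represents-put : ∀ {t T i c u} → Represents t T → c ≡ tapeCode u →
                 Represents (put i c t) (T [ i ≔ u ])
represents-put {t} {T} {i} {c} {u} rep eq = represents at
  where
  at : ∀ j → cell (put i c t) j ≡ tapeCode ((T [ i ≔ u ]) j)
  at j with j ≟ i
  ... | yes refl = trans (cell-here i c t) eq
  ... | no j≢i   = trans (cell-there c t j≢i) (rep .cell-represents j)

represents-initial : ∀ m → Represents (put 0 (numeralCode m) 0) (Config.tapes (initial m))
represents-initial m =
  represents-put {T = λ _ → numeral 0} (represents λ i → refl) (numeralCode-correct m)

numberAt-correct : ∀ {t T} → Represents t T → ∀ i → numberAt t i ≡ number (T i)
numberAt-correct {t} {T} rep i with tape l r ← T i | c ← rep .cell-represents i =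
  trans (cong (λ c → ⟦ onesFn ⟧ (π₂ c ∷ [])) c)
        (trans (cong (λ x → ⟦ onesFn ⟧ (x ∷ [])) (π₂-pair (bits l) (bits r))) (ones-correct r))

parity-cell : ∀ {t T} → Represents t T → ∀ i → parity (π₂ (cell t i)) ≡ encodeSymbol (scanned (T i))
parity-cell {t} {T} rep i with tape l r ← T i | c ← rep .cell-represents i =
  trans (cong (λ c → parity (π₂ c)) c)
        (trans (cong parity (π₂-pair (bits l) (bits r))) (parity-scanned r))
  where
  parity-scanned : ∀ {l} r → parity (bits r) ≡ encodeSymbol (scanned (tape l r))
  parity-scanned []      = refl
  parity-scanned (s ∷ r) = parity-bits s r

-- Primitive recursive indices of the machines

consFn : ∀ {n} → Fn n → Fn n → Fn n
consFn c cs = succ ⟨ pairing ⟨ c ∣ cs ⟩ ⟩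

consFn-correct : ∀ {n} c cs (f g : Fn n) xs → ⟦ f ⟧ xs ≡ encodeInstruction c →
                 ⟦ g ⟧ xs ≡ index cs → ⟦ consFn f g ⟧ xs ≡ index (c ∷ cs)
consFn-correct c cs f g xs = cong₂ (λ x y → suc (pair x y))

prefixFn : ∀ {n} → Program → Fn n → Fn n
prefixFn []       f = f
prefixFn (c ∷ cs) f = consFn (nat (encodeInstruction c)) (prefixFn cs f)

prefixFn-correct : ∀ {n} cs ds (f : Fn n) xs → ⟦ f ⟧ xs ≡ index ds →
                   ⟦ prefixFn cs f ⟧ xs ≡ index (cs ⧺ ds)
prefixFn-correct []       ds f xs eq = eq
prefixFn-correct (c ∷ cs) ds f xs eq =
  consFn-correct c (cs ⧺ ds) (nat (encodeInstruction c)) (prefixFn cs f) xs refl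
    (prefixFn-correct cs ds f xs eq)

-- Instructions depending on a number.  Abstracting from them prevents the
-- unary codes of instructions from being computed.
record Template : Set where
  field
    instanceOf       : ℕ → Instruction
    instanceFn       : Fn 1
    instance-correct : ∀ g → ⟦ instanceFn ⟧ (g ∷ []) ≡ encodeInstruction (instanceOf g)

open Template

actionFn : Bool → Direction → Fn 1 → Fn 1
actionFn s d g = pairing ⟨ nat (encodeSymbol s) ∣ pairing ⟨ nat (encodeDirection d) ∣ g ⟩ ⟩

actTemplate : ℕ → (s₀ : Bool) → Direction → Fn 1 → (s₁ : Bool) → Direction → Fn 1 → Template
actTemplate i s₀ d₀ f s₁ d₁ g .instanceOf n =
  act i (action s₀ d₀ (⟦ f ⟧ (n ∷ []))) (action s₁ d₁ (⟦ g ⟧ (n ∷ [])))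
actTemplate i s₀ d₀ f s₁ d₁ g .instanceFn =
  pairing ⟨ nat 2 ∣ pairing ⟨ nat i ∣ pairing ⟨ actionFn s₀ d₀ f ∣ actionFn s₁ d₁ g ⟩ ⟩ ⟩
actTemplate i s₀ d₀ f s₁ d₁ g .instance-correct n = refl

push₁T push₂T : Template
push₁T = actTemplate 1 false L (var 0F) true L (var 0F)
push₂T = actTemplate 1 true stay (var 0F) true stay (var 0F)

branchT : ℕ → Template
branchT n = actTemplate 1 false stay (var 0F) false R (nat n)

∸-suc-< : ∀ {k v} → suc k ≤ v → v ∸ k ≡ suc (v ∸ suc k)
∸-suc-< {k} = +-∸-assoc 1

end-incs : ∀ v b → end (incs v) b ≡ b + dbl v
end-incs zero    b = sym (+-identityʳ b)
end-incs (suc v) b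
  rewrite end-incs v (suc (suc b)) | +-suc v v | +-suc b (suc (dbl v)) | +-suc b (dbl v) = refl

pushes : (ins₁ ins₂ : Template) → ℕ → ℕ → Program
pushes ins₁ ins₂ zero    b = []
pushes ins₁ ins₂ (suc k) b =
  instanceOf ins₁ (1 + b) ∷ instanceOf ins₂ (2 + b) ∷ pushes ins₁ ins₂ k (2 + b)

assemble-incs : ∀ k b → assemble (incs k) b ≡ pushes push₁T push₂T k b
assemble-incs zero    b = refl
assemble-incs (suc k) b =
  cong (λ cs → push₁ 1 (1 + b) ∷ push₂ 1 (2 + b) ∷ cs) (assemble-incs k (2 + b))

module Layout (base : ℕ) (front middle rest : Program) (ins₁ ins₂ ins₃ : Template) where

  private
    placeFn next₁ next₂ : Fn 3
    placeFn = add ⟨ nat base ∣ double ⟨ monus ⟨ var 2F ∣ succ ⟨ var 0F ⟩ ⟩ ⟩ ⟩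
    next₁    = succ ⟨ placeFn ⟩
    next₂    = succ ⟨ next₁ ⟩

    exit : Fn 1
    exit = succ ⟨ add ⟨ nat base ∣ double ⟨ var 0F ⟩ ⟩ ⟩

  -- The arguments are the number k of increments left and their total number v.
  pushesFn : Fn 2
  pushesFn = recursion (nat (index rest))
    (consFn (instanceFn ins₁ ⟨ next₁ ⟩) (consFn (instanceFn ins₂ ⟨ next₂ ⟩) (var 1F)))

  -- The code of a list grows at its front, so the recursion runs backwards through the table: the
  -- last k of the v increments begin 2(v ∸ k) places after `base`.
  pushesFn-correct : ∀ k v → k ≤ v → ⟦ pushesFn ⟧ (k ∷ v ∷ []) ≡
    index (pushes ins₁ ins₂ k (base + dbl (v ∸ k)) ⧺ rest)
  pushesFn-correct zero    v _   = refl
  pushesFn-correct (suc k) v k<v =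
    cong₂ (λ x y → suc (pair x y)) (instance-correct ins₁ (1 + b))
      (cong₂ (λ x y → suc (pair x y)) (instance-correct ins₂ (2 + b))
        (trans (pushesFn-correct k v (≤-trans (n≤1+n k) k<v))
               (cong (λ b → index (pushes ins₁ ins₂ k b ⧺ rest)) shift)))
    where
    b : ℕ
    b = base + dbl (v ∸ suc k)
    shift : base + dbl (v ∸ k) ≡ 2 + b
    shift rewrite ∸-suc-< k<v | +-suc (v ∸ suc k) (v ∸ suc k)
                | +-suc base (suc (dbl (v ∸ suc k)))
                | +-suc base (dbl (v ∸ suc k)) = refl

  layout : ℕ → Program
  layout v = front ⧺ instanceOf ins₃ (suc (base + dbl v)) ∷ middle ⧺ pushes ins₁ ins₂ v base ⧺ rest

  layoutFn : Fn 1
  layoutFn =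
    prefixFn front (consFn (instanceFn ins₃ ⟨ exit ⟩) (prefixFn middle (pushesFn ⟨ var 0F ∣ var 0F ⟩)))

  layoutFn-correct : ∀ v → ⟦ layoutFn ⟧ (v ∷ []) ≡ index (layout v)
  layoutFn-correct v = prefixFn-correct front _ _ (v ∷ [])
    (cong₂ (λ x y → suc (pair x y)) (instance-correct ins₃ (suc (base + dbl v)))
      (prefixFn-correct middle (pushes ins₁ ins₂ v base ⧺ rest) (pushesFn ⟨ var 0F ∣ var 0F ⟩) (v ∷ [])
        (trans (pushesFn-correct v v ≤-refl)
          (cong (λ b → index (pushes ins₁ ins₂ v b ⧺ rest))
            (trans (cong (λ d → base + dbl d) (n∸n≡0 v)) (+-identityʳ base))))))

module Indexing (kindFn idxFn argFn : Fn 1) (updFn startFn : Fn 2) where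

  open Loop kindFn idxFn argFn updFn startFn
  open Layout constantState front middle (jump 1 ∷ []) push₁T push₂T (branchT (suc branchState))

  opaque
    unfolding machine

    machineFn : Fn 1
    machineFn = layoutFn

    machine-layout : ∀ v → layout v ≡ machine v
    machine-layout v =
      cong₂ (λ x cs → front ⧺ branch 1 (suc x) (suc branchState) ∷ middle ⧺ cs ⧺ jump 1 ∷ [])
        (sym (end-incs v constantState)) (sym (assemble-incs v constantState))

    machineFn-correct : ∀ v → ⟦ machineFn ⟧ (v ∷ []) ≡ index (machine v)
    machineFn-correct v = trans (layoutFn-correct v) (cong index (machine-layout v))


-- States of the interpreter of Kleene computations: w is the index of the
-- interpreter itself.
--   phase 0: run program e with state q and tapes t; when b ≠ 0, loop instead
--            of halting with output 0;
--   phase 1: the same, after the first of the two queries by which a query is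
--            simulated has been answered;
--   phase 2: for k = q, q + 1, … query whether the program e with input (t , k)
--            and flag b converges, and halt if it does not;
--   phase 3: halt.
opaque
  st : (w phase b e q t : ℕ) → ℕ
  st w ph b e q t = pair w (pair ph (pair b (pair e (pair q t))))

stFn : ∀ {n} (w phase b e q t : Fn n) → Fn n
stFn w ph b e q t =
  pairing ⟨ w ∣ pairing ⟨ ph ∣ pairing ⟨ b ∣ pairing ⟨ e ∣ pairing ⟨ q ∣ t ⟩ ⟩ ⟩ ⟩ ⟩

-- Taking the fields of a state and the tag and the body of the instruction as
-- arguments makes the functions below compute as soon as these are known.

private
  wᵛ phᵛ bᵛ eᵛ qᵛ tᵛ sfxᵛ tagᵛ bodyᵛ aᵛ : Fn 10
  wᵛ    = var 0F
  phᵛ   = var 1F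
  bᵛ    = var 2F
  eᵛ    = var 3F
  qᵛ    = var 4F
  tᵛ    = var 5F
  sfxᵛ  = var 6F
  tagᵛ  = var 7F
  bodyᵛ = var 8F
  aᵛ    = var 9F

  byPhase : (x₀ x₁ x₂ x₃ : Fn 10) → Fn 10
  byPhase x₀ x₁ x₂ x₃ =
    ifZero ⟨ phᵛ ∣ x₀ ∣ ifZero ⟨ predecessor ⟨ phᵛ ⟩ ∣ x₁
               ∣ ifZero ⟨ predecessor ⟨ predecessor ⟨ phᵛ ⟩ ⟩ ∣ x₂ ∣ x₃ ⟩ ⟩ ⟩

  byTag : (oracle query act : Fn 10) → Fn 10
  byTag x₀ x₁ x₂ = ifZero ⟨ tagᵛ ∣ x₀ ∣ ifZero ⟨ predecessor ⟨ tagᵛ ⟩ ∣ x₁ ∣ x₂ ⟩ ⟩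

  body₁ body₂ body₂₁ body₂₂ same ask chosen : Fn 10
  body₁  = first ⟨ bodyᵛ ⟩
  body₂  = second ⟨ bodyᵛ ⟩
  body₂₁ = first ⟨ body₂ ⟩
  body₂₂ = second ⟨ body₂ ⟩
  same   = stFn wᵛ phᵛ bᵛ eᵛ qᵛ tᵛ
  -- The phase serves as the flag of the loop asked about: phase 0 asks about the plain interpreter,
  -- phase 1 about the variant.
  ask    = stFn wᵛ (nat 2) phᵛ (numberFn ⟨ tᵛ ∣ body₁ ⟩) (nat 0) (numberFn ⟨ tᵛ ∣ body₂₁ ⟩)
  chosen = ifZero ⟨ parityFn ⟨ second ⟨ cellFn ⟨ tᵛ ∣ body₁ ⟩ ⟩ ⟩ ∣ body₂₁ ∣ body₂₂ ⟩

  initialFn : ∀ {n} (w b e m : Fn n) → Fn n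
  initialFn w b e m = stFn w (nat 0) b e (nat 0) (putFn ⟨ nat 0 ∣ numeralFn ⟨ m ⟩ ∣ nat 0 ⟩)

  sequence : ∀ {n} → Fn n → Fn n → Fn n
  sequence x y = succ ⟨ pairing ⟨ x ∣ succ ⟨ pairing ⟨ y ∣ nat 0 ⟩ ⟩ ⟩ ⟩

  opaque
    kindFn₁₀ argFn₁₀ updFn₁₀ : Fn 10
    kindFn₁₀ =
      -- Every move consults the oracle or issues a query. Performing an `act` instruction and
      -- idling after output 0 are therefore oracle moves (kind 1) whose answer the update ignores.
      byPhase (ifZero ⟨ sfxᵛ ∣ ifZero ⟨ bᵛ ∣ nat 0 ∣ ifZero ⟨ numberFn ⟨ tᵛ ∣ nat 0 ⟩ ∣ nat 1 ∣ nat 0 ⟩ ⟩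
                            ∣ byTag (nat 1) (nat 2) (nat 1) ⟩)
              (nat 2) (nat 2) (nat 0)
    argFn₁₀ =
      byPhase (ifZero ⟨ sfxᵛ ∣ numberFn ⟨ tᵛ ∣ nat 0 ⟩
                            ∣ byTag (numberFn ⟨ tᵛ ∣ body₁ ⟩) ask (nat 0) ⟩)
              ask (initialFn wᵛ bᵛ eᵛ (sequence tᵛ qᵛ)) (nat 0)
    updFn₁₀ =
      byPhase (ifZero ⟨ sfxᵛ ∣ same ∣
                byTag (stFn wᵛ (nat 0) bᵛ eᵛ body₂ (putFn ⟨ body₁ ∣ numeralFn ⟨ aᵛ ⟩ ∣ tᵛ ⟩))
                      -- The answer 0 is ↓: the loop has met a diverging computation. The state is
                      -- then kept, and the same question is asked again forever.
                      (ifZero ⟨ aᵛ ∣ same ∣ stFn wᵛ (nat 1) bᵛ eᵛ qᵛ tᵛ ⟩)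
                      (stFn wᵛ (nat 0) bᵛ eᵛ (second ⟨ second ⟨ chosen ⟩ ⟩)
                        (putFn ⟨ body₁ ∣ performFn ⟨ chosen ∣ cellFn ⟨ tᵛ ∣ body₁ ⟩ ⟩ ∣ tᵛ ⟩)) ⟩)
              (stFn wᵛ (nat 0) bᵛ eᵛ body₂₂ (putFn ⟨ body₂₁ ∣ numeralFn ⟨ aᵛ ⟩ ∣ tᵛ ⟩))
              (ifZero ⟨ aᵛ ∣ stFn wᵛ (nat 2) bᵛ eᵛ (succ ⟨ qᵛ ⟩) tᵛ ∣ stFn wᵛ (nat 3) bᵛ eᵛ qᵛ tᵛ ⟩)
              same

  fields : ∀ {n} (state answer : Fn n) → Vec (Fn n) 10
  fields s a =
    first ⟨ s ⟩ ∷ first ⟨ s₁ ⟩ ∷ first ⟨ s₂ ⟩ ∷ e ∷ q ∷ second ⟨ s₄ ⟩ ∷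
    suffixFn ⟨ e ∣ q ⟩ ∷ first ⟨ c ⟩ ∷ second ⟨ c ⟩ ∷ a ∷ []
    where
    s₁ = second ⟨ s ⟩
    s₂ = second ⟨ s₁ ⟩
    s₃ = second ⟨ s₂ ⟩
    s₄ = second ⟨ s₃ ⟩
    e = first ⟨ s₃ ⟩
    q = first ⟨ s₄ ⟩
    c = first ⟨ predecessor ⟨ suffixFn ⟨ e ∣ q ⟩ ⟩ ⟩

opaque
  kindFn idxFn argFn : Fn 1
  kindFn = kindFn₁₀ · fields (var 0F) (nat 0)
  idxFn  = first
  argFn  = argFn₁₀ · fields (var 0F) (nat 0)

  updFn startFn : Fn 2
  updFn   = updFn₁₀ · fields (var 0F) (var 1F)
  startFn = ifZero ⟨ var 0F ∣ var 1F
                   ∣ initialFn (first ⟨ predecessor ⟨ var 0F ⟩ ⟩) (nat 0)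
                               (second ⟨ predecessor ⟨ var 0F ⟩ ⟩) (var 1F) ⟩

open Loop kindFn idxFn argFn updFn startFn

initialSt : (w b e m : ℕ) → ℕ
initialSt w b e m = st w 0 b e 0 (put 0 (numeralCode m) 0)

opaque
  unfolding st kindFn

  start-zero : ∀ s → start 0 s ≡ s
  start-zero s = refl

  start-suc : ∀ w e m → start (suc (pair w e)) m ≡ initialSt w 0 e m
  start-suc w e m rewrite unpair-pair w e = refl

-- The last three arguments are the code of program e from state q onwards and
-- the tag and the body of the instruction at state q.
data Decodes (e q : ℕ) : (sfx tag body : ℕ) → Set where
  decodes : Decodes e q (suffix e q) (π₁ (π₁ (pred (suffix e q)))) (π₂ (π₁ (pred (suffix e q))))

module _ (w ph b e q t : ℕ) where

  opaque
    unfolding st kindFn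

    fields-st : ∀ {n} (s a : Fn n) xs → ⟦ s ⟧ xs ≡ st w ph b e q t →
      applyAll (fields s a) xs ≡
      (w ∷ ph ∷ b ∷ e ∷ q ∷ t ∷ suffix e q ∷ π₁ (π₁ (pred (suffix e q))) ∷
       π₂ (π₁ (pred (suffix e q))) ∷ ⟦ a ⟧ xs ∷ [])
    fields-st s a xs eq
      rewrite eq
            | unpair-pair w (pair ph (pair b (pair e (pair q t))))
            | unpair-pair ph (pair b (pair e (pair q t)))
            | unpair-pair b (pair e (pair q t))
            | unpair-pair e (pair q t)
            | unpair-pair q t = refl

    idx-st : idx (st w ph b e q t) ≡ w
    idx-st = π₁-pair w _

    kind-st : ∀ {sfx tag body} → Decodes e q sfx tag body → kind (st w ph b e q t) ≡
              ⟦ kindFn₁₀ ⟧ (w ∷ ph ∷ b ∷ e ∷ q ∷ t ∷ sfx ∷ tag ∷ body ∷ 0 ∷ [])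
    kind-st decodes = cong ⟦ kindFn₁₀ ⟧ (fields-st (var 0F) (nat 0) (st w ph b e q t ∷ []) refl)

    arg-st : ∀ {sfx tag body} → Decodes e q sfx tag body → arg (st w ph b e q t) ≡
             ⟦ argFn₁₀ ⟧ (w ∷ ph ∷ b ∷ e ∷ q ∷ t ∷ sfx ∷ tag ∷ body ∷ 0 ∷ [])
    arg-st decodes = cong ⟦ argFn₁₀ ⟧ (fields-st (var 0F) (nat 0) (st w ph b e q t ∷ []) refl)

    upd-st : ∀ {sfx tag body} a → Decodes e q sfx tag body → upd (st w ph b e q t) a ≡
             ⟦ updFn₁₀ ⟧ (w ∷ ph ∷ b ∷ e ∷ q ∷ t ∷ sfx ∷ tag ∷ body ∷ a ∷ [])
    upd-st a decodes = cong ⟦ updFn₁₀ ⟧ (fields-st (var 0F) (var 1F) (st w ph b e q t ∷ a ∷ []) refl)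

data View (e q : ℕ) : Set where
  none   : ∀ {tag body} → Decodes e q 0 tag body → fetch (program e) q ≡ nothing → View e q
  oracle : ∀ {n body} → Decodes e q (suc n) 0 body →
           fetch (program e) q ≡ just (decodeTagged 0 body) → View e q
  query  : ∀ {n body} → Decodes e q (suc n) 1 body →
           fetch (program e) q ≡ just (decodeTagged 1 body) → View e q
  act    : ∀ {n k body} → Decodes e q (suc n) (suc (suc k)) body →
           fetch (program e) q ≡ just (decodeTagged (suc (suc k)) body) → View e q

view : ∀ e q → View e q
view e q = go _ _ _ refl refl refl decodes
  where
  go : ∀ sfx tag body → suffix e q ≡ sfx → π₁ (π₁ (pred sfx)) ≡ tag → π₂ (π₁ (pred sfx)) ≡ body →
       Decodes e q sfx tag body → View e q
  go zero    tag body eq _ _ d = none d (fetch-none e q eq)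
  go (suc n) 0 body eq t refl d =
    oracle d (trans (fetch-some e q eq) (cong (λ k → just (decodeTagged k body)) t))
  go (suc n) 1 body eq t refl d =
    query d (trans (fetch-some e q eq) (cong (λ k → just (decodeTagged k body)) t))
  go (suc n) (suc (suc k)) body eq t refl d =
    act d (trans (fetch-some e q eq) (cong (λ k → just (decodeTagged k body)) t))

chosenAction : (t body : ℕ) → ℕ
chosenAction t body = ifz (parity (π₂ (cell t (π₁ body)))) (π₁ (π₂ body)) (π₂ (π₂ body))

asking : (w b t body : ℕ) → ℕ
asking w b t body = st w 2 b (numberAt t (π₁ body)) 0 (numberAt t (π₁ (π₂ body)))

trial : (w b e k m : ℕ) → ℕ
trial w b e k m = initialSt w b e (encodeSeq (m ∷ k ∷ []))

module _ (w b e q t : ℕ) where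

  opaque
    unfolding st kindFn₁₀

    kind-none : ∀ {tag body} → Decodes e q 0 tag body →
                kind (st w 0 b e q t) ≡ ifz b 0 (ifz (numberAt t 0) 1 0)
    kind-none = kind-st w 0 b e q t

    arg-none : ∀ {tag body} → Decodes e q 0 tag body → arg (st w 0 b e q t) ≡ numberAt t 0
    arg-none = arg-st w 0 b e q t

    upd-none : ∀ {tag body} a → Decodes e q 0 tag body → upd (st w 0 b e q t) a ≡ st w 0 b e q t
    upd-none = upd-st w 0 b e q t

    kind-oracle : ∀ {n body} → Decodes e q (suc n) 0 body → kind (st w 0 b e q t) ≡ 1
    kind-oracle = kind-st w 0 b e q t

    arg-oracle : ∀ {n body} → Decodes e q (suc n) 0 body →
                 arg (st w 0 b e q t) ≡ numberAt t (π₁ body)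
    arg-oracle = arg-st w 0 b e q t

    upd-oracle : ∀ {n body} a → Decodes e q (suc n) 0 body → upd (st w 0 b e q t) a ≡
                 st w 0 b e (π₂ body) (put (π₁ body) (numeralCode a) t)
    upd-oracle = upd-st w 0 b e q t

    kind-query : ∀ {n body} → Decodes e q (suc n) 1 body → kind (st w 0 b e q t) ≡ 2
    kind-query = kind-st w 0 b e q t

    arg-query : ∀ {n body} → Decodes e q (suc n) 1 body → arg (st w 0 b e q t) ≡ asking w 0 t body
    arg-query = arg-st w 0 b e q t

    upd-query : ∀ {n body} a → Decodes e q (suc n) 1 body → upd (st w 0 b e q t) a ≡
                ifz a (st w 0 b e q t) (st w 1 b e q t)
    upd-query = upd-st w 0 b e q t

    kind-act : ∀ {n k body} → Decodes e q (suc n) (suc (suc k)) body → kind (st w 0 b e q t) ≡ 1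
    kind-act = kind-st w 0 b e q t

    upd-act : ∀ {n k body} a → Decodes e q (suc n) (suc (suc k)) body → upd (st w 0 b e q t) a ≡
              st w 0 b e (π₂ (π₂ (chosenAction t body)))
                (put (π₁ body) (performed (chosenAction t body) (cell t (π₁ body))) t)
    upd-act = upd-st w 0 b e q t

    kind-again : kind (st w 1 b e q t) ≡ 2
    kind-again = kind-st w 1 b e q t decodes

    arg-again : ∀ {sfx tag body} → Decodes e q sfx tag body →
                arg (st w 1 b e q t) ≡ asking w 1 t body
    arg-again = arg-st w 1 b e q t

    upd-again : ∀ {sfx tag body} a → Decodes e q sfx tag body → upd (st w 1 b e q t) a ≡
                st w 0 b e (π₂ (π₂ body)) (put (π₁ (π₂ body)) (numeralCode a) t)
    upd-again = upd-st w 1 b e q t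

    kind-loop : kind (st w 2 b e q t) ≡ 2
    kind-loop = kind-st w 2 b e q t decodes

    arg-loop : arg (st w 2 b e q t) ≡ trial w b e q t
    arg-loop = arg-st w 2 b e q t decodes

    upd-loop : ∀ a → upd (st w 2 b e q t) a ≡ ifz a (st w 2 b e (suc q) t) (st w 3 b e q t)
    upd-loop a = upd-st w 2 b e q t a decodes

    kind-stop : kind (st w 3 b e q t) ≡ 0
    kind-stop = kind-st w 3 b e q t decodes

    arg-stop : arg (st w 3 b e q t) ≡ 0
    arg-stop = arg-st w 3 b e q t decodes

halted-flag : ∀ b {x} → ifz b 0 (ifz x 1 0) ≡ 0 → b ≢ 0 → x ≢ 0
halted-flag zero    _  b≢0 _    = b≢0 refl
halted-flag (suc b) () _   refl

flag-kind : ∀ b x → ifz b 0 (ifz x 1 0) ≡ 0 ⊎ ifz b 0 (ifz x 1 0) ≡ 1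
flag-kind zero    x       = inj₁ refl
flag-kind (suc b) zero    = inj₂ refl
flag-kind (suc b) (suc x) = inj₁ refl

-- The interpreter and the program it interprets

module Interpreter (X : ℕ → ℕ) (A : ℕ → ℕ → ℕ → Set) (w : ℕ) where

  open Moves X A

  moves : ∀ {s s′} → s ⟶ s′ → kind s ≢ 0
  moves (oracle-move k)  k₀ with () ← trans (sym k) k₀
  moves (query-move k _) k₀ with () ← trans (sym k) k₀

  ask-move : ∀ {s k s′ a} → kind s ≡ suc (suc k) → idx s ≡ w → arg s ≡ s′ → A w s′ a → s ⟶ upd s a
  ask-move k refl refl x = query-move k x

  ask-inversion : ∀ {s k s′ s″} → kind s ≡ suc (suc k) → idx s ≡ w → arg s ≡ s′ → s ⟶ s″ →
                  ∃[ a ] A w s′ a × s″ ≡ upd s a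
  ask-inversion k _    _    (oracle-move k′)  with () ← trans (sym k) k′
  ask-inversion k refl refl (query-move k′ x) = _ , x , refl

  tell-inversion : ∀ {s s″} → kind s ≡ 1 → s ⟶ s″ → s″ ≡ upd s (X (arg s))
  tell-inversion k (oracle-move k′)  = refl
  tell-inversion k (query-move k′ x) with () ← trans (sym k) k′

  loop-move : ∀ {b e k m a} → A w (trial w b e k m) a →
              st w 2 b e k m ⟶ ifz a (st w 2 b e (suc k) m) (st w 3 b e k m)
  loop-move {b} {e} {k} {m} {a} x =
    subst (st w 2 b e k m ⟶_) (upd-loop w b e k m a)
      (ask-move (kind-loop w b e k m) (idx-st w 2 b e k m) (arg-loop w b e k m) x)

  loop-inversion : ∀ {b e k m s} → st w 2 b e k m ⟶ s →
                   ∃[ a ] A w (trial w b e k m) a × s ≡ ifz a (st w 2 b e (suc k) m) (st w 3 b e k m)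
  loop-inversion {b} {e} {k} {m} x
    with a , y , eq ← ask-inversion (kind-loop w b e k m) (idx-st w 2 b e k m) (arg-loop w b e k m) x =
    a , y , trans eq (upd-loop w b e k m a)

  loop-goes-on : ∀ {b e m} → (∀ k → A w (trial w b e k m) 0) → GoesOn (st w 2 b e 0 m)
  loop-goes-on {b} {e} {m} x = going-on (λ k → st w 2 b e k m) refl λ k → loop-move (x k)

  prepend-stops : ∀ {s s′ n} → s ⟶ s′ → Stops s′ n → Stops s n
  prepend-stops x (stopped xs k a) = stopped (x ◅ xs) k a

  -- Induction on the distance `d` to a known positive answer; an earlier positive answer just stops
  -- the loop sooner.
  loop-stops : ∀ {b e m} (f : ℕ → ℕ) → (∀ k → A w (trial w b e k m) (f k)) →
               ∀ d {k n} → f (d + k) ≡ suc n → Stops (st w 2 b e k m) 0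
  loop-stops {b} {e} {m} f x d {k} eq
    with f k in fk | loop-move {b} {e} {k} {m} (x k)
  ... | suc _ | y = stopped (y ◅ ε) (kind-stop w b e k m) (arg-stop w b e k m)
  loop-stops f x zero eq | zero | y with () ← trans (sym fk) eq
  loop-stops f x (suc d) {k} eq | zero | y =
    prepend-stops y (loop-stops f x d (trans (cong f (+-suc d k)) eq))

  -- At time k the loop is at its k-th trial: a positive answer would have led to phase 3, from
  -- which there is no move.
  loop-went-on : ∀ {b e m} → GoesOn (st w 2 b e 0 m) → ∀ k → A w (trial w b e k m) 0
  loop-went-on {b} {e} {m} (going-on f f₀ mv) k = answer k (at k)
    where
    answer : ∀ k → f k ≡ st w 2 b e k m → A w (trial w b e k m) 0
    next-at : ∀ k → f k ≡ st w 2 b e k m → f (suc k) ≡ st w 2 b e (suc k) m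
    answer k eq with loop-inversion (subst (_⟶ f (suc k)) eq (mv k))
    ... | zero  , x , _   = x
    ... | suc a , _ , eq′ =
      ⊥-elim (moves (subst (_⟶ f (suc (suc k))) eq′ (mv (suc k))) (kind-stop w b e k m))
    next-at k eq with loop-inversion (subst (_⟶ f (suc k)) eq (mv k))
    ... | zero  , _ , eq′ = eq′
    ... | suc a , _ , eq′ =
      ⊥-elim (moves (subst (_⟶ f (suc (suc k))) eq′ (mv (suc k))) (kind-stop w b e k m))
    at : ∀ k → f k ≡ st w 2 b e k m
    at zero    = f₀
    at (suc k) = next-at k (at k)

  loop-stopped : ∀ {b e k m n} → Stops (st w 2 b e k m) n → ∃[ k ] ∃[ a ] A w (trial w b e k m) (suc a)
  loop-stopped {b} {e} {k} {m} (stopped xs k₀ _) = go xs refl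
    where
    go : ∀ {s k} → Star _⟶_ s _ → s ≡ st w 2 b e k m → ∃[ k ] ∃[ a ] A w (trial w b e k m) (suc a)
    go {k = k} ε refl with () ← trans (sym (kind-loop w b e k m)) k₀
    go {k = k} (x ◅ xs) refl with loop-inversion x
    ... | zero  , _ , eq = go xs eq
    ... | suc a , y , _  = k , a , y

  prepend : ∀ {s s′} → s ⟶ s′ → GoesOn s′ → GoesOn s
  prepend {s} x (going-on f refl mv) =
    going-on (λ { zero → s ; (suc t) → f t }) refl λ { zero → x ; (suc t) → mv t }

  idle : ∀ {s} → s ⟶ s → GoesOn s
  idle x = going-on (λ _ → _) refl (λ _ → x)

  go-on-after : ∀ {s s′} → Star _⟶_ s s′ → GoesOn s′ → GoesOn s
  go-on-after ε        g = g
  go-on-after (x ◅ xs) g = prepend x (go-on-after xs g)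

  -- Interpreted computations

  module _ {b e : ℕ} where

    act-represents : ∀ {t T body k} → Represents t T →
      let c = decodeTagged (suc (suc k)) body
          i = π₁ body
          α = choose (scanned (T i)) (decodeAction (π₁ (π₂ body))) (decodeAction (π₂ (π₂ body))) in
      π₂ (π₂ (chosenAction t body)) ≡ Action.goto α ×
      Represents (put i (performed (chosenAction t body) (cell t i)) t)
                 (Config.tapes (perform α i T))
    act-represents {t} {T} {body} rep =
      go (scanned (T (π₁ body)))
         (cong (λ p → ifz p (π₁ (π₂ body)) (π₂ (π₂ body))) (parity-cell rep (π₁ body)))
      where
      go : ∀ s {c} → c ≡ ifz (encodeSymbol s) (π₁ (π₂ body)) (π₂ (π₂ body)) →
           let α = choose s (decodeAction (π₁ (π₂ body))) (decodeAction (π₂ (π₂ body))) in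
           π₂ (π₂ c) ≡ Action.goto α ×
           Represents (put (π₁ body) (performed c (cell t (π₁ body))) t)
                      (Config.tapes (perform α (π₁ body) T))
      go false {c} refl =
        refl , represents-put rep
          (trans (cong (performed c) (rep .cell-represents (π₁ body))) (performed-correct c (T (π₁ body))))
      go true {c} refl =
        refl , represents-put rep
          (trans (cong (performed c) (rep .cell-represents (π₁ body))) (performed-correct c (T (π₁ body))))

    answer-represents : ∀ {t T i n n′} → Represents t T → n ≡ n′ →
                        Represents (put i (numeralCode n) t) (T [ i ≔ numeral n′ ])
    answer-represents {t} {T} {n = n} rep refl = represents-put rep (numeralCode-correct n)

    asking-represents : ∀ {t T} body → Represents t T → ∀ b → asking w b t body ≡
                        st w 2 b (number (T (π₁ body))) 0 (number (T (π₁ (π₂ body))))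
    asking-represents body rep b =
      cong₂ (λ i j → st w 2 b i 0 j) (numberAt-correct rep _) (numberAt-correct rep _)

    module _ (B : ℕ → ℕ → ℕ → Set) where

      _↝_ : Config → Config → Set
      _↝_ = Step X B (program e)

      -- The answers the interpreter has to receive in order to follow a program whose queries are
      -- answered by `B`; a positive answer to the first query stands for ↑. `Justified` below is
      -- the converse.
      Answered : Set
      Answered = ∀ {e′ m′ a} → B e′ m′ a →
                 (∃[ n ] A w (st w 2 0 e′ 0 m′) (suc n)) × A w (st w 2 1 e′ 0 m′) a

      Follows : ℕ → ℕ → Config → Set
      Follows t q (config q′ T′) =
        ∃[ t′ ] Star _⟶_ (st w 0 b e q t) (st w 0 b e q′ t′) × Represents t′ T′

      act-move : ∀ {n k t q body} → Decodes e q (suc n) (suc (suc k)) body → st w 0 b e q t ⟶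
                 st w 0 b e (π₂ (π₂ (chosenAction t body)))
                   (put (π₁ body) (performed (chosenAction t body) (cell t (π₁ body))) t)
      act-move {t = t} {q} d =
        subst (_ ⟶_) (upd-act w b e q t _ d) (oracle-move (kind-act w b e q t d))

      follow-step : Answered → ∀ {q T c t} → config q T ↝ c → Represents t T → Follows t q c
      follow-step ans {q} {t = t} s rep with view e q
      follow-step ans (act-step f)     rep | none d g with () ← trans (sym f) g
      follow-step ans (oracle-step f)  rep | none d g with () ← trans (sym f) g
      follow-step ans (query-step f _) rep | none d g with () ← trans (sym f) g
      follow-step ans (act-step f)     rep | oracle d g with () ← trans (sym f) g
      follow-step ans (query-step f _) rep | oracle d g with () ← trans (sym f) g
      follow-step ans (act-step f)     rep | query d g with () ← trans (sym f) g
      follow-step ans (oracle-step f)  rep | query d g with () ← trans (sym f) g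
      follow-step ans (oracle-step f)  rep | act d g with () ← trans (sym f) g
      follow-step ans (query-step f _) rep | act d g with () ← trans (sym f) g
      follow-step ans {q} {T} {t = t} (oracle-step f) rep | oracle {body = body} d g
        with refl ← trans (sym f) g =
        _ , subst (_ ⟶_) (upd-oracle w b e q t _ d) (oracle-move (kind-oracle w b e q t d)) ◅ ε ,
        answer-represents rep
          (cong X (trans (arg-oracle w b e q t d) (numberAt-correct rep (π₁ body))))
      follow-step ans {q} {T} {t = t} (act-step f) rep | act {body = body} d g
        with refl ← trans (sym f) g
        with goto , rep′ ← act-represents {t} {T} {body} {0} rep =
        _ , subst (λ q′ → _ ⟶ st w 0 b e q′ _) goto (act-move d) ◅ ε , rep′
      follow-step ans {q} {T} {t = t} (query-step {a = a} f x) rep | query {body = body} d g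
        with refl ← trans (sym f) g
        with (n , y) , z ← ans x =
        _ , subst (_ ⟶_) (upd-query w b e q t (suc n) d)
              (ask-move (kind-query w b e q t d) (idx-st w 0 b e q t)
                (trans (arg-query w b e q t d) (asking-represents body rep 0)) y) ◅
            subst (_ ⟶_) (upd-again w b e q t a d)
              (ask-move (kind-again w b e q t) (idx-st w 1 b e q t)
                (trans (arg-again w b e q t d) (asking-represents body rep 1)) z) ◅ ε ,
        answer-represents rep refl

      follow : Answered → ∀ {q T c t} → Star _↝_ (config q T) c → Represents t T → Follows t q c
      follow ans ε        rep = _ , ε , rep
      follow ans (x ◅ xs) rep
        with _ , y , rep₁ ← follow-step ans x rep
        with _ , z , rep₂ ← follow ans xs rep₁ = _ , y ◅◅ z , rep₂

      halt-kind : ∀ {q T t} → Represents t T → fetch (program e) q ≡ nothing →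
                  kind (st w 0 b e q t) ≡ ifz b 0 (ifz (number (T 0)) 1 0) ×
                  arg (st w 0 b e q t) ≡ number (T 0) ×
                  ∀ a → upd (st w 0 b e q t) a ≡ st w 0 b e q t
      halt-kind {q} {T} {t} rep g with view e q
      ... | none d _ =
        trans (kind-none w b e q t d) (cong (λ n → ifz b 0 (ifz n 1 0)) (numberAt-correct rep 0)) ,
        trans (arg-none w b e q t d) (numberAt-correct rep 0) ,
        λ a → upd-none w b e q t a d
      ... | oracle _ f with () ← trans (sym f) g
      ... | query _ f  with () ← trans (sym f) g
      ... | act _ f    with () ← trans (sym f) g

      Completes : Config → ℕ → Set
      Completes c n = (∃[ c′ ] Star _↝_ c c′ × fetch (program e) (Config.state c′) ≡ nothing ×
                               output c′ ≡ n) × (b ≢ 0 → n ≢ 0)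

      precede : ∀ {c c′ n} → c ↝ c′ → Completes c′ n → Completes c n
      precede x ((_ , xs , h) , nz) = (_ , x ◅ xs , h) , nz

      Justified : Set
      Justified = ∀ {e′ m′ n a} → A w (st w 2 0 e′ 0 m′) (suc n) → A w (st w 2 1 e′ 0 m′) a →
                  B e′ m′ a

      module _ (just-by : Justified) {n s′ : ℕ} (k₀ : kind s′ ≡ 0) (a₀ : arg s′ ≡ n) where

        -- A halting run of the interpreter is read back as a run of the program. Idling after
        -- output 0 and repeating an unsuccessful first query correspond to no step and are dropped;
        -- since the recursion is on the given finite run, these cases call for no separate
        -- refutation.
        parse  : ∀ {s} → Star _⟶_ s s′ → ∀ {q t T} → s ≡ st w 0 b e q t → Represents t T →
                 Completes (config q T) n
        parse₁ : ∀ {s} → Star _⟶_ s s′ → ∀ {q t T k body m} → s ≡ st w 1 b e q t → Represents t T →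
                 Decodes e q (suc k) 1 body → fetch (program e) q ≡ just (decodeTagged 1 body) →
                 A w (st w 2 0 (number (T (π₁ body))) 0 (number (T (π₁ (π₂ body))))) (suc m) →
                 Completes (config q T) n
        parse xs {q} {t} {T} refl rep with view e q
        parse ε {q} {t} {T} refl rep | none d g
          with k , a , _ ← halt-kind rep g =
          (_ , ε , g , trans (sym a) a₀) ,
          λ b≢0 n≡0 → halted-flag b (trans (sym k) k₀) b≢0 (trans (sym a) (trans a₀ n≡0))
        parse (x ◅ xs) {q} {t} {T} refl rep | none d g
          with k , _ , u ← halt-kind rep g
          with flag-kind b (number (T 0))
        ... | inj₁ z = ⊥-elim (moves x (trans k z))
        ... | inj₂ o = parse xs (trans (tell-inversion (trans k o) x) (u _)) rep
        parse ε {q} {t} refl rep | oracle d g with () ← trans (sym k₀) (kind-oracle w b e q t d)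
        parse (x ◅ xs) {q} {t} refl rep | oracle {body = body} d g =
          precede (oracle-step g)
            (parse xs (trans (tell-inversion (kind-oracle w b e q t d) x) (upd-oracle w b e q t _ d))
              (answer-represents rep
                (cong X (trans (arg-oracle w b e q t d) (numberAt-correct rep (π₁ body))))))
        parse ε {q} {t} refl rep | query d g with () ← trans (sym k₀) (kind-query w b e q t d)
        parse (x ◅ xs) {q} {t} refl rep | query {body = body} d g
          with ask-inversion (kind-query w b e q t d) (idx-st w 0 b e q t)
                 (trans (arg-query w b e q t d) (asking-represents body rep 0)) x
        ... | zero  , _ , eq = parse xs (trans eq (upd-query w b e q t 0 d)) rep
        ... | suc m , y , eq = parse₁ xs (trans eq (upd-query w b e q t (suc m) d)) rep d g y
        parse ε {q} {t} refl rep | act d g with () ← trans (sym k₀) (kind-act w b e q t d)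
        parse (x ◅ xs) {q} {t} refl rep | act {body = body} d g
          with goto , rep′ ← act-represents {body = body} {0} rep =
          precede (act-step g)
            (parse xs (trans (tell-inversion (kind-act w b e q t d) x)
                        (trans (upd-act w b e q t _ d) (cong (λ q′ → st w 0 b e q′ _) goto))) rep′)
        parse₁ ε {q} {t} refl rep d g y with () ← trans (sym k₀) (kind-again w b e q t)
        parse₁ (x ◅ xs) {q} {t} {body = body} refl rep d g y
          with a , z , eq ← ask-inversion (kind-again w b e q t) (idx-st w 1 b e q t)
                              (trans (arg-again w b e q t d) (asking-represents body rep 1)) x =
          precede (query-step g (just-by y z))
            (parse xs (trans eq (upd-again w b e q t a d)) (answer-represents rep refl))

-- Comparison of the two fixed points

module Semantics (X : ℕ → ℕ) where

  -- Induction principles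

  module _ (P : ℕ → ℕ → ℕ → Set) where

    Γ-Both : ℕ → ℕ → ℕ → Set
    Γ-Both e m n = Γ∞ X e m n × P e m n

    module _ (ih : ∀ {e m n} → Γ X Γ-Both e m n → P e m n) where

      Γ-induction : ∀ {e m n} → Γ∞ X e m n → P e m n
      Γ-steps : ∀ {p c c′} → Star (Step X (ΓAnswer (Γ∞ X)) p) c c′ →
                Star (Step X (ΓAnswer Γ-Both) p) c c′
      Γ-step : ∀ {p c c′} → Step X (ΓAnswer (Γ∞ X)) p c c′ → Step X (ΓAnswer Γ-Both) p c c′
      Γ-induction (fix (halts xs h o)) = ih (halts (Γ-steps xs) h o)
      Γ-steps ε        = ε
      Γ-steps (x ◅ xs) = Γ-step x ◅ Γ-steps xs
      Γ-step (act-step f)    = act-step f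
      Γ-step (oracle-step f) = oracle-step f
      Γ-step (query-step f (y , x , z)) =
        query-step f (y , (λ k → x k , Γ-induction (x k)) , z)

  module _ (P : ℕ → ℕ → Verdict → Value → Set) where

    I-Both : ℕ → ℕ → Verdict → Value → Set
    I-Both e m j k = I∞ X e m j k × P e m j k

    module _ (ih : ∀ {e m j k} → I X I-Both e m j k → P e m j k) where

      I-induction : ∀ {e m j k} → I∞ X e m j k → P e m j k
      I-steps : ∀ {p c c′} → Star (Step X (IAnswer (I∞ X)) p) c c′ →
                Star (Step X (IAnswer I-Both) p) c c′
      I-step : ∀ {p c c′} → Step X (IAnswer (I∞ X)) p c c′ → Step X (IAnswer I-Both) p c c′
      I-induction (fix (converges (halts xs h o))) = ih (converges (halts (I-steps xs) h o))
      I-induction (fix (diverges (runs-forever r r₀ xs))) =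
        ih (diverges (runs-forever r r₀ λ t → I-step (xs t)))
      I-steps ε        = ε
      I-steps (x ◅ xs) = I-step x ◅ I-steps xs
      I-step (act-step f)    = act-step f
      I-step (oracle-step f) = oracle-step f
      I-step (query-step f (j , k , x , a)) =
        query-step f (j , k , (x , I-induction x) , a)

  -- Feedback computations have only one outcome

  -- Answers depend on the verdict alone, so uniqueness of verdicts for the computations asked about
  -- makes a run deterministic.
  Decided : ℕ → ℕ → Verdict → Value → Set
  Decided e m j k = ∀ {j′ k′} → I∞ X e m j′ k′ → j ≡ j′

  module _ {p : Program} where

    deterministic-step : ∀ {c c₁ c₂} → Step X (IAnswer (I-Both Decided)) p c c₁ →
                         Step X (IAnswer (I∞ X)) p c c₂ → c₁ ≡ c₂
    deterministic-step (act-step f)    (act-step g)     with refl ← trans (sym f) g = refl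
    deterministic-step (act-step f)    (oracle-step g)  with () ← trans (sym f) g
    deterministic-step (act-step f)    (query-step g _) with () ← trans (sym f) g
    deterministic-step (oracle-step f) (act-step g)     with () ← trans (sym f) g
    deterministic-step (oracle-step f) (oracle-step g)  with refl ← trans (sym f) g = refl
    deterministic-step (oracle-step f) (query-step g _) with () ← trans (sym f) g
    deterministic-step (query-step f _) (act-step g)    with () ← trans (sym f) g
    deterministic-step (query-step f _) (oracle-step g) with () ← trans (sym f) g
    deterministic-step (query-step f (_ , _ , (_ , d) , refl)) (query-step g (_ , _ , y , refl))
      with refl ← trans (sym f) g
      with refl ← d y = refl

    halting-not-running : ∀ {c c′} → Star (Step X (IAnswer (I-Both Decided)) p) c c′ →
      fetch p (Config.state c′) ≡ nothing → (r : ℕ → Config) →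
      (∀ t → Step X (IAnswer (I∞ X)) p (r t) (r (suc t))) → ∀ t → r t ≡ c → ⊥
    halting-not-running ε        h r ys t refl = step-fetch (ys t) h
    halting-not-running (x ◅ xs) h r ys t refl =
      halting-not-running xs h r ys (suc t) (sym (deterministic-step x (ys t)))

    running-not-halting : ∀ {c c′} (r : ℕ → Config) →
      (∀ t → Step X (IAnswer (I-Both Decided)) p (r t) (r (suc t))) →
      Star (Step X (IAnswer (I∞ X)) p) c c′ → fetch p (Config.state c′) ≡ nothing →
      ∀ t → r t ≡ c → ⊥
    running-not-halting r xs ε        h t refl = step-fetch (xs t) h
    running-not-halting r xs (y ◅ ys) h t refl =
      running-not-halting r xs ys h (suc t) (deterministic-step (xs t) y)

  decided : ∀ {e m j k} → I∞ X e m j k → Decided e m j k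
  decided = I-induction Decided outcome
    where
    outcome : ∀ {e m j k} → I X (I-Both Decided) e m j k → Decided e m j k
    outcome (converges _) (fix (converges _)) = refl
    outcome (diverges _)  (fix (diverges _))  = refl
    outcome (converges (halts xs h _)) (fix (diverges (runs-forever r r₀ ys))) =
      ⊥-elim (halting-not-running xs h r ys 0 r₀)
    outcome (diverges (runs-forever r r₀ xs)) (fix (converges (halts ys h _))) =
      ⊥-elim (running-not-halting r xs ys h 0 r₀)

  module _ {w : ℕ} (w≡machine : program w ≡ machine 0) where

    loopSt : (b e m : ℕ) → ℕ
    loopSt b e m = st w 2 b e 0 m

    module _ (C : ℕ → ℕ → Verdict → Value → Set) where

      open Moves X (IAnswer C)

      stops-converges : ∀ {s n} → Stops s n → I X C w s ↓ (just n)
      stops-converges {s} {n} x = converges (stops-halts X (IAnswer C) w≡machine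
        (subst (λ s → Stops s n) (sym (start-zero s)) x))

      goes-on-diverges : ∀ {s} → GoesOn s → I X C w s ↑ nothing
      goes-on-diverges {s} x = diverges (goes-on-runs X (IAnswer C) w≡machine
        (subst GoesOn (sym (start-zero s)) x))

      converges-stops : ∀ {s k} → I X C w s ↓ k → ∃[ n ] k ≡ just n × Stops s n
      converges-stops {s} (converges {n} x) =
        n , refl , subst (λ s → Stops s n) (start-zero s) (halts-stops X (IAnswer C) w≡machine x)

      diverges-goes-on : ∀ {s k} → I X C w s ↑ k → GoesOn s
      diverges-goes-on {s} (diverges x) =
        subst GoesOn (start-zero s) (runs-goes-on X (IAnswer C) w≡machine x)

    -- Kleene computations are feedback computations

    -- For output 0 the variant has to diverge outright: if it froze, the loop asking about it would
    -- freeze as well, and E would receive no value.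
    Interpreted : ℕ → ℕ → ℕ → Set
    Interpreted e m n =
      I∞ X w (initialSt w 0 e m) ↓ (just n) ×
      (n ≢ 0 → I∞ X w (initialSt w 1 e m) ↓ (just n)) ×
      (n ≡ 0 → I∞ X w (initialSt w 1 e m) ↑ nothing)

    private
      A∞ : ℕ → ℕ → ℕ → Set
      A∞ = IAnswer (I∞ X)

    answer : ∀ {e m j k} → I∞ X e m j k → A∞ e m (verdictCode j)
    answer x = _ , _ , x , refl

    open Moves X A∞
    open Interpreter X A∞ w

    -- The second loop finds the value of E.
    answered : ∀ {b e} → Answered {b} {e} (ΓAnswer (Γ-Both Interpreted))
    answered {e′ = e′} {m′} (y , x , z) =
      -- All trials converge by the induction hypothesis, so the first loop runs forever; its
      -- verdict ↑ is received as 1, the successor of the witness 0.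
      (0 , answer (fix (goes-on-diverges (I∞ X)
        (loop-goes-on λ k → answer (x k .proj₂ .proj₁))))) , outcome z
      where
      trial-answer : ∀ k → A∞ w (trial w 1 e′ k m′) (ifz (y k) 1 0)
      trial-answer k with y k | x k .proj₂
      ... | zero  | _ , _ , i = answer (i refl)
      ... | suc n | _ , i , _ = answer (i λ ())
      outcome : ∀ {a} → E y a → A∞ w (loopSt 1 e′ m′) a
      outcome (E-zero (n , yn)) =
        answer (fix (stops-converges (I∞ X) (loop-stops (λ k → ifz (y k) 1 0) trial-answer n
          (trans (cong (λ k → ifz (y k) 1 0) (+-identityʳ n)) (cong (λ v → ifz v 1 0) yn)))))
      outcome (E-one y≢0) = answer (fix (goes-on-diverges (I∞ X) (loop-goes-on λ k →
        subst (A∞ w _) (ifz-suc 1 0 (y≢0 k)) (trial-answer k))))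

    interpreted : ∀ {e m n} → Γ X (Γ-Both Interpreted) e m n → Interpreted e m n
    interpreted {e} {m} {n} (halts {c} xs h o) =
      fix (stops-converges (I∞ X) (stopping 0 λ z → ⊥-elim (z refl))) ,
      (λ n≢0 → fix (stops-converges (I∞ X) (stopping 1 λ _ → n≢0))) ,
      (λ n≡0 → fix (goes-on-diverges (I∞ X) (looping n≡0)))
      where
      stopping : ∀ b → (b ≢ 0 → n ≢ 0) → Stops (initialSt w b e m) n
      stopping b nz
        with _ , ys , rep ← follow {b} (ΓAnswer (Γ-Both Interpreted)) (answered {b} {e}) xs
                             (represents-initial m)
        with k , a , _ ← halt-kind {b} (ΓAnswer (Γ-Both Interpreted)) rep h =
        stopped ys (trans k (flag b (subst (λ n → b ≢ 0 → n ≢ 0) (sym o) nz))) (trans a o)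
        where
        flag : ∀ b {x} → (b ≢ 0 → x ≢ 0) → ifz b 0 (ifz x 1 0) ≡ 0
        flag zero    nz = refl
        flag (suc b) nz = ifz-suc 1 0 (nz λ ())
      looping : n ≡ 0 → GoesOn (initialSt w 1 e m)
      looping n≡0
        with t , ys , rep ← follow {1} (ΓAnswer (Γ-Both Interpreted)) (answered {1} {e}) xs
                             (represents-initial m)
        with k , a , u ← halt-kind {1} (ΓAnswer (Γ-Both Interpreted)) rep h =
        -- With the flag set and output 0, the halting state of the program gives an oracle move
        -- from a state to itself.
        go-on-after ys (idle (subst (st w 0 1 e (Config.state c) t ⟶_) (u _)
          (oracle-move (trans k (cong (λ x → ifz x 1 0) (trans o n≡0))))))

    kleene⇒feedback : ∀ {e m n} → Γ∞ X e m n → Interpreted e m n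
    kleene⇒feedback = Γ-induction Interpreted interpreted

    -- Feedback computations of the interpreter are Kleene computations

    -- The induction ranges over all feedback computations; the equations single out those of the
    -- interpreter on its own states. The last clause yields only a diverging trial. That the value
    -- in question is 0 is concluded in `justified`, where the value is already known to exist.
    Faithful : ℕ → ℕ → Verdict → Value → Set
    Faithful i s j k = i ≡ w →
      (∀ b e m → s ≡ initialSt w b e m → j ≡ ↓ → ∃[ n ] k ≡ just n × Γ∞ X e m n × (b ≢ 0 → n ≢ 0)) ×
      (∀ b e m → s ≡ st w 2 b e 0 m → j ≡ ↑ →
        ∀ k → ∃[ n ] Γ∞ X e (encodeSeq (m ∷ k ∷ [])) n × (b ≢ 0 → n ≢ 0)) ×
      (∀ b e m → s ≡ st w 2 b e 0 m → j ≡ ↓ → ∃[ k ] ∃[ v ] I∞ X w (trial w b e k m) ↑ v)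

    private
      C : ℕ → ℕ → Verdict → Value → Set
      C = I-Both Faithful

    -- A positive first answer can only be ↑, so the first loop supplies the values y(k). If the
    -- second loop diverges as well, all values are nonzero. If it halts, some flagged trial
    -- diverges, and a positive value there would make that trial converge by `kleene⇒feedback`,
    -- against `decided`.
    justified : ∀ {b e} → Interpreter.Justified X (IAnswer C) w {b} {e} (ΓAnswer (Γ∞ X))
    justified {m′ = m′} (↑ , _ , (_ , F) , _) (↑ , _ , (_ , G) , refl)
      with f ← G refl .proj₂ .proj₁ 1 _ m′ refl refl =
      (λ k → f k .proj₁) , (λ k → f k .proj₂ .proj₁) , E-one λ k → f k .proj₂ .proj₂ λ ()
    justified {m′ = m′} (↑ , _ , (_ , F) , _) (↓ , _ , (_ , G) , refl)
      with f ← F refl .proj₂ .proj₁ 0 _ m′ refl refl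
      with k , _ , x ← G refl .proj₂ .proj₂ 1 _ m′ refl refl =
      (λ k → f k .proj₁) , (λ k → f k .proj₂ .proj₁) , E-zero (k , zero-at)
      where
      zero-at : f k .proj₁ ≡ 0
      zero-at with f k
      ... | zero  , _     = refl
      ... | suc n , y , _ = case decided x (kleene⇒feedback y .proj₂ .proj₁ λ ()) of λ ()

    faithful : ∀ {i s j k} → I X C i s j k → Faithful i s j k
    faithful x refl =
      (λ { b e m refl refl → halting b e m x }) ,
      (λ { b e m refl refl → running b e m x }) ,
      (λ { b e m refl refl → failing b e m x })
      where
      open module J = Interpreter X (IAnswer C) w using ()
      halting : ∀ b e m {k} → I X C w (initialSt w b e m) ↓ k →
                ∃[ n ] k ≡ just n × Γ∞ X e m n × (b ≢ 0 → n ≢ 0)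
      halting b e m x
        with n , eq , Moves.stopped xs k₀ a₀ ← converges-stops C x
        with (_ , ys , h , o) , nz ← J.parse {b} {e} (ΓAnswer (Γ∞ X)) (justified {b} {e}) k₀ a₀ xs refl
                                       (represents-initial m) =
        n , eq , fix (halts ys h o) , nz
      running : ∀ b e m {k} → I X C w (st w 2 b e 0 m) ↑ k →
                ∀ k → ∃[ n ] Γ∞ X e (encodeSeq (m ∷ k ∷ [])) n × (b ≢ 0 → n ≢ 0)
      running b e m x k with J.loop-went-on (diverges-goes-on C x) k
      ... | ↓ , _ , (_ , F) , _ with n , _ , y ← F refl .proj₁ b e _ refl refl = n , y
      failing : ∀ b e m {k} → I X C w (st w 2 b e 0 m) ↓ k → ∃[ k ] ∃[ v ] I∞ X w (trial w b e k m) ↑ v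
      failing b e m x
        with _ , _ , y ← converges-stops C x
        with J.loop-stopped y
      ... | k , _ , ↑ , v , (z , _) , _ = k , v , z

    feedback⇒kleene : ∀ {e m n} → I∞ X w (initialSt w 0 e m) ↓ (just n) → Γ∞ X e m n
    feedback⇒kleene x
      with _ , refl , y , _ ← I-induction Faithful faithful x refl .proj₁ 0 _ _ refl refl =
      y

    -- Machine `k` on input `m` and machine `w` on the initial state for `e` and `m` enter their
    -- common loop in the same state, so halting passes from one to the other through `Stops`.
    universal : ∀ {k e} → program k ≡ machine (suc (pair w e)) → ∀ m → kleene e m X ≃ feedback k X m
    universal {k} {e} k≡machine m n = mk⇔ to from
      where
      to : Γ∞ X e m n → I∞ X k m ↓ (just n)
      to x with fix y ← kleene⇒feedback x .proj₁
           with _ , refl , z ← converges-stops (I∞ X) y =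
        fix (converges (stops-halts X A∞ k≡machine
          (subst (λ s → Stops s n) (sym (start-suc w e m)) z)))
      from : I∞ X k m ↓ (just n) → Γ∞ X e m n
      from (fix (converges x)) = feedback⇒kleene (fix (stops-converges (I∞ X)
        (subst (λ s → Stops s n) (start-suc w e m) (halts-stops X A∞ k≡machine x))))

-- The translation of indices

open Indexing kindFn idxFn argFn updFn startFn

interpreter : ℕ
interpreter = index (machine 0)

translate : ℕ → ℕ
translate e = index (machine (suc (pair interpreter e)))

translateFn : Fn 1
translateFn = machineFn ⟨ succ ⟨ pairing ⟨ nat interpreter ∣ var 0F ⟩ ⟩ ⟩

theorem1p3 : Σ[ k₀ ∈ (ℕ → ℕ) ] (PrimitiveRecursive k₀ ×
    (∀ (e m : ℕ) (X : ℕ → ℕ) → kleene e m X ≃ feedback (k₀ e) X m))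
theorem1p3 =
  translate ,
  (code translateFn , λ e → trans (correct translateFn (e ∷ []))
                                  (machineFn-correct (suc (pair interpreter e)))) ,
  λ e m X → Semantics.universal X (program-index (machine 0))
              (program-index (machine (suc (pair interpreter e)))) m
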